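{- There exist sets $A,B\subseteq\Sigma^*$ such that $B\leq^p_{s\text{ - }li\text{ - }T}A$, $B\leq^p_{s\text{ - }ld\text{ - }T}A$, and $B\not\leq^p_{tt}A$.
   Context: $\Sigma=\{0,1\}$; $|x|$ is the length of $x$; $\chi_A$ is the characteristic function of $A$; $\langle\cdot,\dots,\cdot\rangle$ is a one-to-one, polynomial-time computable and invertible multiarity pairing function. A DPTM is a deterministic oracle Turing machine $M$ for which there is one polynomial $p$ such that, for every oracle $X\subseteq\Sigma^*$ and input $x$, $M^X(x)$ halts within $p(|x|)$ steps; $L(M^X)$ is the set of inputs accepted with oracle $X$. $B\leq^p_{tt}A$: there are a deterministic polynomial-time machine $M$ (without oracle) and a polynomial-time computable $f$ such that for each $x$ there is an integer $m$ with $f(x)=\langle q_1,\dots,q_m\rangle$, and $M(\langle x,\chi_A(q_1),\dots,\chi_A(q_m)\rangle)$ accepts if and only if $x\in B$. $B\leq^p_{s\text{ - }li\text{ - }T}A$ (respectively $B\leq^p_{s\text{ - }ld\text{ - }T}A$): there is a DPTM $M$ with $L(M^A)=B$ such that for every input $x$, either $M^A(x)$ makes no oracle queries, or the sequence $q_1,\dots,q_k$ ($k\ge1$), in order, of its queries satisfies $|x|<|q_1|<|q_2|<\dots<|q_k|$ (respectively $|x|>|q_1|>|q_2|>\dots>|q_k|$). -}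

module Defs where

open import Data.Bool.Base using (Bool; true; false; T)
open import Data.Fin.Base using (Fin)
open import Data.List.Base
  using (List; []; _∷_; [_]; _++_; _ʳ++_; map; concatMap; foldr; length)
open import Data.List.Relation.Unary.Linked using (Linked)
open import Data.Nat.Base using (ℕ; zero; suc; _+_; _*_; _<_; _>_)
open import Data.Product.Base using (Σ-syntax; ∃-syntax; _×_; _,_)
open import Data.Sum.Base using (_⊎_)
open import Data.Vec.Base as Vec using (Vec; lookup; replicate; zipWith; _[_]≔_)
open import Function.Bundles using (_⇔_)
open import Function.Definitions using (Injective)
open import Relation.Binary.PropositionalEquality using (_≡_; _≢_)

infix 4 _∈_ _≤s-li-T_ _≤s-ld-T_
infix 5 _accepts_with-oracle_

-- Σ* with Σ = {0,1}; 0 is false and 1 is true.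
Word : Set
Word = List Bool

-- A set of words, given by its characteristic function χ.
Language : Set
Language = Word → Bool

_∈_ : Word → Language → Set
x ∈ L = T (L x)

-- Coefficients, constant term first.
Polynomial : Set
Polynomial = List ℕ

eval : Polynomial → ℕ → ℕ
eval p n = foldr (λ c v → c + n * v) 0 p

------------------------------------------------------------------------
-- Deterministic multitape oracle Turing machines

-- Every machine may use g auxiliary tape symbols of its own.  The comma
-- serves to write tuples of words on a tape.
data Symbol (g : ℕ) : Set where
  blank : Symbol g
  bit   : Bool → Symbol g
  comma : Symbol g
  aux   : Fin g → Symbol g

data Move : Set where
  left stay right : Move

-- `ask y n` consumes one step: it queries the oracle about the word on
-- the query tape and continues in state y or n according to the answer.
data Instruction (states tapes g : ℕ) : Set where
  accept reject : Instruction states tapes g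
  ask : (yes no : Fin states) → Instruction states tapes g
  act : (Vec (Symbol g) tapes → Fin states × Vec (Symbol g × Move) tapes) →
        Instruction states tapes g

-- The three distinguished tapes are allowed to coincide.
record Machine : Set where
  field
    states tapes g     : ℕ
    start              : Fin states
    input query output : Fin tapes
    program            : Fin states → Instruction states tapes g

-- Tapes are infinite to the right only.  The cells left of the head are
-- listed nearest first; all cells beyond `after` are blank.
record Tape (g : ℕ) : Set where
  constructor tape
  field
    before : List (Symbol g)
    head   : Symbol g
    after  : List (Symbol g)

load : ∀ {g} → List (Symbol g) → Tape g
load []      = tape [] blank []
load (a ∷ w) = tape [] a w

-- A left move on the leftmost cell leaves the head in place.
move : ∀ {g} → Move → Tape g → Tape g
move left  (tape []      a r)       = tape [] a r
move left  (tape (b ∷ l) a r)       = tape l b (a ∷ r)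
move stay  t                        = t
move right (tape l       a [])      = tape (a ∷ l) blank []
move right (tape l       a (b ∷ r)) = tape (a ∷ l) b r

write : ∀ {g} → Tape g → Symbol g × Move → Tape g
write (tape l _ r) (a , m) = move m (tape l a r)

cells : ∀ {g} → Tape g → List (Symbol g)
cells (tape l a r) = l ʳ++ (a ∷ r)

untilBlank : ∀ {g} → List (Symbol g) → List (Symbol g)
untilBlank []          = []
untilBlank (blank ∷ _) = []
untilBlank (a ∷ w)     = a ∷ untilBlank w

leadingBits : ∀ {g} → List (Symbol g) → Word
leadingBits (bit b ∷ w) = b ∷ leadingBits w
leadingBits _           = []

record Config (M : Machine) : Set where
  constructor config
  open Machine M
  field
    state    : Fin states
    contents : Vec (Tape g) tapes

Input : Machine → Set
Input M = List (Symbol (Machine.g M))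

module _ (M : Machine) where
  open Machine M

  initial : Input M → Config M
  initial w = config start (replicate tapes (load []) [ input ]≔ load w)

  current : Config M → Instruction states tapes g
  current (config s _) = program s

  -- The query is the word written from the left end of the query tape, up
  -- to the first cell that does not hold a bit.
  queryWord : Config M → Word
  queryWord (config _ ts) = leadingBits (cells (lookup ts query))

  outputWord : Config M → List (Symbol g)
  outputWord (config _ ts) = untilBlank (cells (lookup ts output))

  -- The oracle answer does not alter the tapes.  Halted configurations
  -- are fixed points.
  step : Language → Config M → Config M
  step X c@(config s ts) with program s
  ... | accept = c
  ... | reject = c
  ... | act δ with δ (Vec.map Tape.head ts)
  ...   | s′ , ws = config s′ (zipWith write ts ws)
  step X c@(config s ts) | ask y n with X (queryWord c)
  ...   | true  = config y ts
  ...   | false = config n ts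

  run : Language → ℕ → Config M → Config M
  run X zero    c = c
  run X (suc t) c = run X t (step X c)

  queriedBy : Config M → List Word
  queriedBy c with current c
  ... | ask _ _ = [ queryWord c ]
  ... | _       = []

  queriesFrom : Language → ℕ → Config M → List Word
  queriesFrom X zero    c = []
  queriesFrom X (suc t) c = queriedBy c ++ queriesFrom X t (step X c)

  Halted : Config M → Set
  Halted c = current c ≡ accept ⊎ current c ≡ reject

  HaltsWithin : Language → ℕ → Input M → Set
  HaltsWithin X t w = Halted (run X t (initial w))

  Accepts : Language → Input M → Set
  Accepts X w = ∃[ t ] current (run X t (initial w)) ≡ accept

  OracleFree : Set
  OracleFree = ∀ s y n → program s ≢ ask y n

bits : ∀ {g} → Word → List (Symbol g)
bits = map bit

tuple : ∀ {g} → List Word → List (Symbol g)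
tuple = concatMap (λ w → bits w ++ [ comma ])

-- The oracle of an oracle-free machine is irrelevant.
∅ : Language
∅ _ = false

------------------------------------------------------------------------
-- Polynomial time

record DPTM : Set where
  field
    machine : Machine
    bound   : Polynomial
    halts   : ∀ (X : Language) (x : Word) →
              HaltsWithin machine X (eval bound (length x)) (bits x)

_accepts_with-oracle_ : DPTM → Word → Language → Set
D accepts x with-oracle X = Accepts (DPTM.machine D) X (bits x)

-- All queries of the computation, in order: by the time bound it has halted.
queries : DPTM → Language → Word → List Word
queries D X x =
  queriesFrom machine X (eval bound (length x)) (initial machine (bits x))
  where open DPTM D

-- The partial map sending `inp i` to `out i`, for each i, is computable in
-- polynomial time; nothing is required on inputs that are not some `inp i`.
PolyTimeComputable : {I : Set} → (inp out : ∀ {g} → I → List (Symbol g)) → Set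
PolyTimeComputable {I} inp out =
  Σ[ M ∈ Machine ] OracleFree M ×
  Σ[ p ∈ Polynomial ] ∀ (i : I) →
    let w = inp {Machine.g M} i
        c = run M ∅ (eval p (length w)) (initial M w)
    in Halted M c × outputWord M c ≡ out i

record PairingFunction : Set where
  field
    ⟨_⟩        : List Word → Word
    injective  : Injective _≡_ _≡_ ⟨_⟩
    computable : PolyTimeComputable tuple (λ ws → bits ⟨ ws ⟩)
    invertible : PolyTimeComputable (λ ws → bits ⟨ ws ⟩) tuple

------------------------------------------------------------------------
-- Reductions

module _ (P : PairingFunction) where
  open PairingFunction P

  infix 4 TruthTableReducible

  TruthTableReducible : Language → Language → Set
  TruthTableReducible B A =
    Σ[ M ∈ DPTM ] OracleFree (DPTM.machine M) ×
    Σ[ f ∈ (Word → Word) ] PolyTimeComputable bits (λ x → bits (f x)) ×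
    (∀ (x : Word) → Σ[ qs ∈ List Word ]
      f x ≡ ⟨ qs ⟩ ×
      (M accepts ⟨ x ∷ map (λ q → [ A q ]) qs ⟩ with-oracle ∅ ⇔ x ∈ B))

  syntax TruthTableReducible P B A = B ≤tt[ P ] A

-- `Linked _~_` relates consecutive entries, so it holds trivially when
-- there are no queries.
TuringReducibleAlong : (ℕ → ℕ → Set) → Language → Language → Set
TuringReducibleAlong _~_ B A =
  Σ[ M ∈ DPTM ]
    (∀ (x : Word) → M accepts x with-oracle A ⇔ x ∈ B) ×
    (∀ (x : Word) → Linked _~_ (length x ∷ map length (queries M A x)))

_≤s-li-T_ : Language → Language → Set
_≤s-li-T_ = TuringReducibleAlong _<_

_≤s-ld-T_ : Language → Language → Set
_≤s-ld-T_ = TuringReducibleAlong _>_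

{-# OPTIONS --safe #-}
module Submission where

-- On inputs of length n = 3 + 2m a walk asks m unary words, whose answers spell
-- an address w of m bits, and then accepts iff a leaf word containing w belongs
-- to the oracle.  The unary words may have lengths n-1, n-2, ... followed by a
-- short leaf, or n+1, n+2, ... followed by a long one, so the same set B is
-- reducible in both ways if A stores, for sparsely many m, the same address and
-- the same answer in both places.  A truth-table reduction fixes its queries
-- before it sees the address, and they are polynomially many: at the stage where
-- it is treated, some w among the 2^m addresses has neither leaf among them, and
-- the answer stored there is set against the verdict, which does not depend on it.

open import Defs
open import Data.Bool.Base using (Bool; true; false; T; if_then_else_; not; _∧_; _∨_)
import Data.Bool.Properties as Bool
open import Data.Empty using (⊥; ⊥-elim)
open import Data.Fin.Base as Fin using (Fin)
open import Data.List.Base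
  using (List; []; _∷_; [_]; _++_; _ʳ++_; map; length; replicate; reverse; tabulate; lookup; take; drop)
import Data.List.Properties as List
open import Data.List.Membership.Propositional using () renaming (_∈_ to _∈ˡ_; _∉_ to _∉ˡ_)
open import Data.List.Membership.Propositional.Properties using (∈-++⁺ˡ; ∈-++⁺ʳ; ∈-map⁺)
open import Data.List.Relation.Unary.Any using (here; there)
open import Data.List.Relation.Unary.Linked using (Linked; [-]; _∷_)
open import Data.Maybe.Base as Maybe using (Maybe; just; nothing; maybe′)
open import Data.Nat.Base
open import Data.Nat.ListAction using (sum)
open import Data.Nat.Properties
open import Data.Nat.Solver using (module +-*-Solver)
open import Data.Product.Base using (Σ-syntax; _×_; _,_; proj₁; proj₂; uncurry)
open import Data.Sum.Base using (_⊎_; inj₁; inj₂)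
open import Data.Unit.Base using (tt)
open import Data.Vec.Base as Vec using (Vec; []; _∷_)
import Data.Vec.Properties as Vec
open import Function.Base using (_∘_; case_of_; id)
open import Function.Bundles using (_⇔_; mk⇔; Equivalence)
open import Relation.Binary.Definitions using (tri<; tri≈; tri>)
open import Relation.Binary.PropositionalEquality hiding ([_])
open import Relation.Nullary.Decidable using (does; yes; no; dec-true; dec-false)
open import Relation.Nullary.Negation.Core using (¬_)

-- The walking machines

-- The two walks must agree on every length `3 + 2m`, also when no zone belongs to `m` and the
-- addresses they read may differ. The leaf words are built for this: the length of a leaf gives `m`
-- and its last bit gives the direction, so a leaf can lie in the oracle only if `m` belongs to a
-- zone, and there both walks read the same address. The words of a zone have lengths from `2 + m`
-- (the downward leaf) to `6 + 4 * m` (the upward leaf); consecutive zones are spaced so that these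
-- intervals are disjoint. Whether a pair of machines is a truth-table reduction cannot be decided,
-- so a stage is carried out for every candidate, with total functions throughout; its useful
-- properties are proved only for candidates that compute what they should. As programs contain
-- functions, the enumeration reaches a machine only up to equal behaviour, which is enough because
-- a stage only runs it. Of the pairing function only its machines are known; that a short code has
-- few components is read off the running time of the inverting machine.

module Execution (M : Machine) (X : Language) where

  infix 4 _⟶⟨_,_⟩_
  infixr 5 _▷_

  -- Final configuration and query list are kept together, so that one composition `_▷_` adds the
  -- times and concatenates the queries.
  record _⟶⟨_,_⟩_ (c : Config M) (t : ℕ) (qs : List Word) (c′ : Config M) : Set where
    constructor _,_
    field
      runs : run M X t c ≡ c′
      asks : queriesFrom M X t c ≡ qs

  run-+ : ∀ s t c → run M X (s + t) c ≡ run M X t (run M X s c)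
  run-+ zero    t c = refl
  run-+ (suc s) t c = run-+ s t (step M X c)

  queriesFrom-+ : ∀ s t c →
    queriesFrom M X (s + t) c ≡ queriesFrom M X s c ++ queriesFrom M X t (run M X s c)
  queriesFrom-+ zero    t c = refl
  queriesFrom-+ (suc s) t c = trans
    (cong (queriedBy M c ++_) (queriesFrom-+ s t (step M X c)))
    (sym (List.++-assoc (queriedBy M c) _ _))

  _▷_ : ∀ {c₁ c₂ c₃ s t qs rs} → c₁ ⟶⟨ s , qs ⟩ c₂ → c₂ ⟶⟨ t , rs ⟩ c₃ →
        c₁ ⟶⟨ s + t , qs ++ rs ⟩ c₃
  _▷_ {c₁} {s = s} {t} (refl , refl) (refl , refl) =
    run-+ s t c₁ , queriesFrom-+ s t c₁

  step-halted : ∀ c → Halted M c → step M X c ≡ c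
  step-halted (config s ts) h with Machine.program M s
  step-halted (config s ts) h         | accept  = refl
  step-halted (config s ts) h         | reject  = refl
  step-halted (config s ts) (inj₁ ()) | ask _ _
  step-halted (config s ts) (inj₂ ()) | ask _ _
  step-halted (config s ts) (inj₁ ()) | act _
  step-halted (config s ts) (inj₂ ()) | act _

  queriedBy-halted : ∀ c → Halted M c → queriedBy M c ≡ []
  queriedBy-halted c h with current M c
  queriedBy-halted c h         | accept  = refl
  queriedBy-halted c h         | reject  = refl
  queriedBy-halted c (inj₁ ()) | ask _ _
  queriedBy-halted c (inj₂ ()) | ask _ _
  queriedBy-halted c h         | act _   = refl

  rest : ∀ t {c} → Halted M c → c ⟶⟨ t , [] ⟩ c
  rest zero        h = refl , refl
  rest (suc t) {c} h = (step-halted c h , cong (_++ []) (queriedBy-halted c h)) ▷ rest t h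

  run-from-halted : ∀ {s t c} → s ≤ t → Halted M (run M X s c) → run M X t c ≡ run M X s c
  run-from-halted {s} {t} {c} s≤t h = begin
    run M X t c                         ≡⟨ cong (λ k → run M X k c) (m+[n∸m]≡n s≤t) ⟨
    run M X (s + (t ∸ s)) c             ≡⟨ run-+ s (t ∸ s) c ⟩
    run M X (t ∸ s) (run M X s c)       ≡⟨ _⟶⟨_,_⟩_.runs (rest (t ∸ s) h) ⟩
    run M X s c                         ∎
    where open ≡-Reasoning

  extend : ∀ {c c′ t t′ qs} → t ≤ t′ → c ⟶⟨ t , qs ⟩ c′ → Halted M c′ → c ⟶⟨ t′ , qs ⟩ c′
  extend {c} {c′} {t} {t′} {qs} t≤t′ r h =
    subst₂ (λ k l → c ⟶⟨ k , l ⟩ c′) (m+[n∸m]≡n t≤t′) (List.++-identityʳ qs) (r ▷ rest (t′ ∸ t) h)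

  -- `Accepts` leaves the time open; since halted configurations are fixed points, the state at any
  -- halting time settles it.
  accepts-halted : ∀ {t w} → Halted M (run M X t (initial M w)) →
    Accepts M X w → current M (run M X t (initial M w)) ≡ accept
  accepts-halted {t} {w} h (s , acc) with ≤-total s t
  ... | inj₁ s≤t = trans (cong (current M) (run-from-halted s≤t (inj₁ acc))) acc
  ... | inj₂ t≤s = trans (cong (current M) (sym (run-from-halted t≤s h))) acc

-- Input lengths and the program of the walkers

zeros : ℕ → Word
zeros n = replicate n false

inputLength : ℕ → ℕ
inputLength m = 3 + (m + m)

half : ℕ → Maybe ℕ
half zero          = just 0
half (suc zero)    = nothing
half (suc (suc n)) = Maybe.map suc (half n)

addressSize : ℕ → Maybe ℕ
addressSize (suc (suc (suc n))) = half n
addressSize _                   = nothing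

data Shape : ℕ → Set where
  short    : ∀ {n} → n ≤ 2 → Shape n
  balanced : ∀ m → Shape (inputLength m)
  lopsided : ∀ m → Shape (suc (inputLength m))

shape : ∀ n → Shape n
shape 0 = short z≤n
shape 1 = short (s≤s z≤n)
shape 2 = short ≤-refl
shape 3 = balanced 0
shape (suc (suc (suc (suc n)))) with shape (suc (suc n))
... | short (s≤s (s≤s z≤n)) = lopsided 0
... | balanced m = subst Shape (cong (4 +_) (+-suc m m)) (balanced (suc m))
... | lopsided m = subst Shape (cong (5 +_) (+-suc m m)) (lopsided (suc m))

half-double : ∀ m → half (m + m) ≡ just m
half-double zero    = refl
half-double (suc m) rewrite +-suc m m | half-double m = refl

half-double+1 : ∀ m → half (suc (m + m)) ≡ nothing
half-double+1 zero    = refl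
half-double+1 (suc m) rewrite +-suc m m | half-double+1 m = refl

pattern skip₀ = Fin.zero
pattern skip₁ = Fin.suc skip₀
pattern skip₂ = Fin.suc skip₁
pattern even  = Fin.suc skip₂
pattern odd   = Fin.suc even
pattern loop  = Fin.suc odd
pattern query = Fin.suc loop
pattern yes!  = Fin.suc query
pattern no!   = Fin.suc yes!
pattern mark  = Fin.suc no!
pattern copy  = Fin.suc mark
pattern leaf  = Fin.suc copy
pattern halt⁺ = Fin.suc leaf
pattern halt⁻ = Fin.suc halt⁺

answered decided : Bool → Fin 14
answered b = if b then yes! else no!
decided  b = if b then halt⁺ else halt⁻

-- The first tape is cleared to zeros and then serves as query tape.  The second
-- gets a comma for every second input symbol; the commas are overwritten, from
-- right to left, by the answers, which are finally copied to the query tape.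
walker : (turn : Move) (pad : Symbol 0) (dir : Move) → Machine
walker turn pad dir = record
  { states = 14 ; tapes = 2 ; g = 0
  ; start = skip₀
  ; input = Fin.zero ; query = Fin.zero ; output = Fin.zero
  ; program = program
  }
  where
  program : Fin 14 → Instruction 14 2 0
  program skip₀ = act λ where
    -- The blank put on the second tape is the sentinel by which `loop` recognises that every comma
    -- has been used.
    (bit _ ∷ s ∷ []) → skip₁ , (bit false , right) ∷ (blank , right) ∷ []
    (q ∷ s ∷ [])     → halt⁻ , (q , stay) ∷ (s , stay) ∷ []
  program skip₁ = act λ where
    (bit _ ∷ s ∷ []) → skip₂ , (bit false , right) ∷ (s , stay) ∷ []
    (q ∷ s ∷ [])     → halt⁻ , (q , stay) ∷ (s , stay) ∷ []
  program skip₂ = act λ where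
    (bit _ ∷ s ∷ []) → even , (bit false , right) ∷ (s , stay) ∷ []
    (q ∷ s ∷ [])     → halt⁻ , (q , stay) ∷ (s , stay) ∷ []
  program even = act λ where
    (bit _ ∷ s ∷ []) → odd , (bit false , right) ∷ (s , stay) ∷ []
    (q ∷ s ∷ [])     → loop , (q , turn) ∷ (s , left) ∷ []
  program odd = act λ where
    (bit _ ∷ s ∷ []) → even , (bit false , right) ∷ (comma , right) ∷ []
    (q ∷ s ∷ [])     → halt⁻ , (q , stay) ∷ (s , stay) ∷ []
  program loop = act λ where
    (q ∷ comma ∷ []) → query , (pad , dir) ∷ (comma , stay) ∷ []
    -- One more padding move is made on leaving the loop; it makes the downward leaf shorter than
    -- the last unary query.
    (q ∷ s ∷ [])     → mark , (pad , dir) ∷ (s , right) ∷ []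
  program query = ask yes! no!
  program yes!  = act λ where (q ∷ s ∷ []) → loop , (q , stay) ∷ (bit true , left) ∷ []
  program no!   = act λ where (q ∷ s ∷ []) → loop , (q , stay) ∷ (bit false , left) ∷ []
  -- This `true` keeps leaf words apart from the unary words.
  program mark  = act λ where (q ∷ s ∷ []) → copy , (bit true , dir) ∷ (s , stay) ∷ []
  program copy  = act λ where
    (q ∷ bit b ∷ []) → copy , (bit b , dir) ∷ (bit b , right) ∷ []
    -- Written last, this `false` ends the upward leaf, whereas the downward leaf ends with the
    -- `true` of `mark`.
    (q ∷ s ∷ [])     → leaf , (bit false , dir) ∷ (s , stay) ∷ []
  program leaf  = ask halt⁺ halt⁻
  program halt⁺ = accept
  program halt⁻ = reject

-- padded m i j is the query tape when i padding moves out of m + 1 are made and j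
-- are left; marked m j v is the query tape when v is written of the leaf word and
-- j symbols are left.  The word lengths are chosen such that only the last move of
-- the downward walk, which no longer matters, is blocked by the end of the tape.
record Direction : Set where
  field
    turn dir  : Move
    pad       : Symbol 0
    position  : (m i j : ℕ) → ℕ
    leafWord  : ℕ → Word → Word
    padded    : (m i j : ℕ) → Tape 0
    marked    : (m j : ℕ) → Word → Tape 0
    final     : ℕ → Word → Tape 0
    turned    : ∀ m → move turn (tape (bits (zeros (inputLength m))) blank []) ≡ padded m 0 (suc m)
    pad-step  : ∀ m i j → write (padded m i (suc j)) (pad , dir) ≡ padded m (suc i) j
    pad-word  : ∀ m i j → leadingBits (cells (padded m (suc i) (suc j))) ≡ zeros (position m i j)
    padded-marked : ∀ m → padded m (suc m) 0 ≡ marked m (suc m) []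
    mark-step : ∀ m j b v → write (marked m (suc j) v) (bit b , dir) ≡ marked m j (b ∷ v)
    mark-last : ∀ m v → write (marked m 0 v) (bit false , dir) ≡ final m v
    mark-word : ∀ m v → leadingBits (cells (final m (v ++ [ true ]))) ≡ leafWord m v

-- Runs of a walker with an arbitrary oracle

module Walk (D : Direction) (X : Language) where
  open Direction D

  M : Machine
  M = walker turn pad dir
  open Execution M X

  answers : (m i j : ℕ) → Word
  answers m i zero    = []
  answers m i (suc j) = X (zeros (position m i j)) ∷ answers m (suc i) j

  addressQueries : (m i j : ℕ) → List Word
  addressQueries m i zero    = []
  addressQueries m i (suc j) = zeros (position m i j) ∷ addressQueries m (suc i) j

  leafQuery : ℕ → Word
  leafQuery m = leafWord m (answers m 0 m)

  commas : ℕ → List (Symbol 0)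
  commas i = replicate i comma ++ [ blank ]

  -- The head is on the next comma to be overwritten, or on the sentinel when none is left; the
  -- answers so far stand to its right, latest first.
  storing : ℕ → Word → Tape 0
  storing zero    as = tape [] blank (bits as ++ [ blank ])
  storing (suc j) as = tape (commas j) comma (bits as ++ [ blank ])

  reading : List (Symbol 0) → Word → Tape 0
  reading l []       = tape l blank []
  reading l (a ∷ as) = tape l (bit a) (bits as ++ [ blank ])

  sweeping : ℕ → Word → Tape 0
  sweeping k []      = tape (bits (zeros k)) blank []
  sweeping k (b ∷ y) = tape (bits (zeros k)) (bit b) (bits y)

  at : Fin 14 → Tape 0 → Tape 0 → Config M
  at s q r = config s (q ∷ r ∷ [])

  move-right-sweeping : ∀ k b y → write (sweeping k (b ∷ y)) (bit false , right) ≡ sweeping (suc k) y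
  move-right-sweeping k b []      = refl
  move-right-sweeping k b (_ ∷ y) = refl

  sweep-even : ∀ m k i y → length y ≡ m + m →
    at even (sweeping k y) (tape (commas i) blank []) ⟶⟨ m + m , [] ⟩
    at even (tape (bits (zeros (k + (m + m)))) blank []) (tape (commas (i + m)) blank [])
  sweep-even zero k i [] eq rewrite +-identityʳ k | +-identityʳ i = refl , refl
  sweep-even (suc m) k i [] ()
  sweep-even (suc m) k i (_ ∷ []) eq with () ← trans (suc-injective eq) (+-suc m m)
  sweep-even (suc m) k i (a ∷ b ∷ y) eq
    rewrite +-suc m m | +-suc k (suc (m + m)) | +-suc k (m + m) | +-suc i m =
    two ▷ sweep-even m (2 + k) (suc i) y (suc-injective (suc-injective eq))
    where
    two : at even (sweeping k (a ∷ b ∷ y)) (tape (commas i) blank []) ⟶⟨ 2 , [] ⟩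
          at even (sweeping (2 + k) y) (tape (commas (suc i)) blank [])
    two = cong (λ q → at even q _) (move-right-sweeping (suc k) b y) , refl

  sweep-odd : ∀ m k i y → length y ≡ suc (m + m) →
    Σ[ c ∈ Config M ] at even (sweeping k y) (tape (commas i) blank []) ⟶⟨ 2 + (m + m) , [] ⟩ c ×
      current M c ≡ reject
  sweep-odd zero k i (a ∷ []) eq = _ , (refl , refl) , refl
  sweep-odd (suc m) k i (a ∷ []) ()
  sweep-odd (suc m) k i (a ∷ b ∷ y) eq
    rewrite +-suc m m with sweep-odd m (2 + k) (suc i) y (suc-injective (suc-injective eq))
  ... | c , r , rej = c , two ▷ r , rej
    where
    two : at even (sweeping k (a ∷ b ∷ y)) (tape (commas i) blank []) ⟶⟨ 2 , [] ⟩
          at even (sweeping (2 + k) y) (tape (commas (suc i)) blank [])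
    two = cong (λ q → at even q _) (move-right-sweeping (suc k) b y) , refl

  queryStep : ∀ q r {w} → leadingBits (cells q) ≡ w →
    at query q r ⟶⟨ 1 , [ w ] ⟩ at (answered (X w)) q r
  queryStep q r refl = moved , refl
    where
    moved : step M X (at query q r) ≡ at (answered (X (leadingBits (cells q)))) q r
    moved with X (leadingBits (cells q))
    ... | true  = refl
    ... | false = refl

  leafStep : ∀ q r {w} → leadingBits (cells q) ≡ w →
    at leaf q r ⟶⟨ 1 , [ w ] ⟩ at (decided (X w)) q r
  leafStep q r refl = moved , refl
    where
    moved : step M X (at leaf q r) ≡ at (decided (X (leadingBits (cells q)))) q r
    moved with X (leadingBits (cells q))
    ... | true  = refl
    ... | false = refl

  storeStep : ∀ b j q as →
    at (answered b) q (storing (suc j) as) ⟶⟨ 1 , [] ⟩ at loop q (storing j (b ∷ as))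
  storeStep true  zero    (tape _ _ _) as = refl , refl
  storeStep true  (suc j) (tape _ _ _) as = refl , refl
  storeStep false zero    (tape _ _ _) as = refl , refl
  storeStep false (suc j) (tape _ _ _) as = refl , refl

  padStep : ∀ m i j k as →
    at loop (padded m i (suc j)) (storing (suc k) as) ⟶⟨ 1 , [] ⟩
    at query (padded m (suc i) j) (storing (suc k) as)
  padStep m i j k as rewrite sym (pad-step m i j) = refl , refl

  -- Three steps per answer: pad, ask, store. One padding move remains at the end, for leaving the
  -- loop.
  gather : ∀ m i j as →
    at loop (padded m i (suc j)) (storing j as) ⟶⟨ j * 3 , addressQueries m i j ⟩
    at loop (padded m (i + j) 1) (storing 0 (answers m i j ʳ++ as))
  gather m i zero    as rewrite +-identityʳ i = refl , refl
  gather m i (suc j) as rewrite +-suc i j =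
    padStep m i (suc j) j as ▷
    queryStep _ _ (pad-word m i j) ▷
    storeStep (X (zeros (position m i j))) j _ as ▷
    gather m (suc i) j (X (zeros (position m i j)) ∷ as)

  readingStep : ∀ l as → move right (tape l blank (bits as ++ [ blank ])) ≡ reading (blank ∷ l) as
  readingStep l []       = refl
  readingStep l (a ∷ as) = refl

  lastPad : ∀ m as →
    at loop (padded m m 1) (storing 0 as) ⟶⟨ 1 , [] ⟩ at mark (marked m (suc m) []) (reading [ blank ] as)
  lastPad m as
    rewrite sym (readingStep [] as) | sym (padded-marked m) | sym (pad-step m m 0) = refl , refl

  reading-next : ∀ l a as → write (reading l (a ∷ as)) (bit a , right) ≡ reading (bit a ∷ l) as
  reading-next l a []       = refl
  reading-next l a (_ ∷ as) = refl

  reading-stay : ∀ l as → write (reading l as) (Tape.head (reading l as) , stay) ≡ reading l as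
  reading-stay l []       = refl
  reading-stay l (_ ∷ as) = refl

  markStep : ∀ m j l as →
    at mark (marked m (suc j) []) (reading l as) ⟶⟨ 1 , [] ⟩ at copy (marked m j [ true ]) (reading l as)
  markStep m j l as =
    cong₂ (at copy) (mark-step m j true []) (reading-stay l as) , refl

  copyStep : ∀ m j v l a as →
    at copy (marked m (suc j) v) (reading l (a ∷ as)) ⟶⟨ 1 , [] ⟩
    at copy (marked m j (a ∷ v)) (reading (bit a ∷ l) as)
  copyStep m j v l a as = cong₂ (at copy) (mark-step m j a v) (reading-next l a as) , refl

  copying : ∀ m v l as → Σ[ r ∈ Tape 0 ]
    at copy (marked m (length as) v) (reading l as) ⟶⟨ suc (length as) , [] ⟩
    at leaf (final m (as ʳ++ v)) r
  copying m v l []       = _ , cong (λ q → at leaf q (reading l [])) (mark-last m v) , refl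
  copying m v l (a ∷ as) with copying m (a ∷ v) (bit a ∷ l) as
  ... | r , c = r , copyStep m (length as) v l a as ▷ c

  length-answers : ∀ m i j → length (answers m i j) ≡ j
  length-answers m i zero    = refl
  length-answers m i (suc j) = cong suc (length-answers m (suc i) j)

  turnStep : ∀ m →
    at even (tape (bits (zeros (inputLength m))) blank []) (tape (commas m) blank []) ⟶⟨ 1 , [] ⟩
    at loop (padded m 0 (suc m)) (storing m [])
  turnStep zero    = cong (λ q → at loop q _) (turned 0) , refl
  turnStep (suc m) = cong (λ q → at loop q _) (turned (suc m)) , refl

  walk : ∀ m → Σ[ q ∈ Tape 0 ] Σ[ r ∈ Tape 0 ]
    at loop (padded m 0 (suc m)) (storing m [])
      ⟶⟨ m * 3 + (2 + (suc m + 1)) , addressQueries m 0 m ++ [ leafQuery m ] ⟩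
    at (decided (X (leafQuery m))) q r
  walk m = _ , _ , gather m 0 m [] ▷ lastPad m as ▷ markStep m m [ blank ] as ▷ copied ▷ leafStep _ _ word
    where
    as : Word
    as = answers m 0 m ʳ++ []

    length-as : length as ≡ m
    length-as = trans (List.length-reverse (answers m 0 m)) (length-answers m 0 m)

    -- Answers are stored leftwards and copied from the left. The two reversals cancel, so the
    -- address lists the answers in the order of asking.
    restored : as ʳ++ [ true ] ≡ answers m 0 m ++ [ true ]
    restored = List.ʳ++-ʳ++ (answers m 0 m)

    r : Tape 0
    r = proj₁ (copying m [ true ] [ blank ] as)

    copied : at copy (marked m m [ true ]) (reading [ blank ] as) ⟶⟨ suc m , [] ⟩
             at leaf (final m (answers m 0 m ++ [ true ])) r
    copied = subst₂
      (λ k v → at copy (marked m k [ true ]) (reading [ blank ] as) ⟶⟨ suc k , [] ⟩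
               at leaf (final m v) r)
      length-as restored (proj₂ (copying m [ true ] [ blank ] as))

    word : leadingBits (cells (final m (answers m 0 m ++ [ true ]))) ≡ leafQuery m
    word = mark-word m (answers m 0 m)

  skip : ∀ a₀ a₁ a₂ y →
    initial M (bits (a₀ ∷ a₁ ∷ a₂ ∷ y)) ⟶⟨ 3 , [] ⟩ at even (sweeping 3 y) (tape [ blank ] blank [])
  skip a₀ a₁ a₂ y = cong (λ q → at even q _) (move-right-sweeping 2 a₂ y) , refl

  Outcome : Word → Bool → List Word → Set
  Outcome x b qs = Σ[ t ∈ ℕ ] t ≤ 10 + 6 * length x × Σ[ c ∈ Config M ]
    initial M (bits x) ⟶⟨ t , qs ⟩ c × current M c ≡ (if b then accept else reject)

  outcome-odd : ∀ m x → length x ≡ inputLength m →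
    Outcome x (X (leafQuery m)) (addressQueries m 0 m ++ [ leafQuery m ])
  outcome-odd m x@(a₀ ∷ a₁ ∷ a₂ ∷ y) eq with walk m
  ... | q , r , w =
    _ , bound , _ ,
    skip a₀ a₁ a₂ y ▷ sweep-even m 3 0 y (cong (_∸ 3) eq) ▷ turnStep m ▷ w ,
    verdict (X (leafQuery m))
    where
    verdict : ∀ b → current M (at (decided b) q r) ≡ (if b then accept else reject)
    verdict true  = refl
    verdict false = refl

    bound : 3 + ((m + m) + (1 + (m * 3 + (1 + (1 + (suc m + 1)))))) ≤ 10 + 6 * length x
    bound = begin
      3 + ((m + m) + (1 + (m * 3 + (1 + (1 + (suc m + 1)))))) ≡⟨ solve 1 (λ m →
          con 3 :+ ((m :+ m) :+ (con 1 :+ (m :* con 3 :+ (con 1 :+ (con 1 :+ ((con 1 :+ m) :+ con 1)))))) :=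
          con 8 :+ con 6 :* m) refl m ⟩
      8 + 6 * m                 ≤⟨ +-mono-≤ (m≤m+n 8 2) (*-monoʳ-≤ 6 (≤-trans (m≤m+n m m) (m≤n+m (m + m) 3))) ⟩
      10 + 6 * inputLength m    ≡⟨ cong (λ n → 10 + 6 * n) eq ⟨
      10 + 6 * length x         ∎
      where
      open ≤-Reasoning
      open +-*-Solver

  outcome-even : ∀ m x → length x ≡ suc (inputLength m) → Outcome x false []
  outcome-even m x@(a₀ ∷ a₁ ∷ a₂ ∷ y) eq with sweep-odd m 3 0 y (cong (_∸ 3) eq)
  ... | c , r , rej = _ , bound , _ , skip a₀ a₁ a₂ y ▷ r , rej
    where
    bound : 5 + (m + m) ≤ 10 + 6 * length x
    bound = ≤-trans (+-mono-≤ (m≤m+n 5 5) (≤-trans (m≤n+m (m + m) 4) (≤-reflexive (sym eq))))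
              (+-monoʳ-≤ 10 (m≤n*m (length x) 6))

  outcome-short : ∀ x → length x ≤ 2 → Outcome x false []
  outcome-short []          _ = 1 , m≤m+n 1 9 , _ , (refl , refl) , refl
  outcome-short (_ ∷ [])    _ = 2 , m≤m+n 2 14 , _ , (refl , refl) , refl
  outcome-short (_ ∷ _ ∷ []) _ = 3 , m≤m+n 3 19 , _ , (refl , refl) , refl
  outcome-short (_ ∷ _ ∷ _ ∷ _) (s≤s (s≤s ()))

  -- The input enters only through its length, which is why the diagonalization can work with inputs
  -- consisting of zeros.
  verdict : ℕ → Bool
  verdict n = maybe′ (λ m → X (leafQuery m)) false (addressSize n)

  verdict-inputLength : ∀ m → verdict (inputLength m) ≡ X (leafQuery m)
  verdict-inputLength m rewrite half-double m = refl

  queriesAt : ℕ → List Word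
  queriesAt n = maybe′ (λ m → addressQueries m 0 m ++ [ leafQuery m ]) [] (addressSize n)

  outcome : ∀ x → Outcome x (verdict (length x)) (queriesAt (length x))
  outcome x = go (length x) refl (shape (length x))
    where
    go : ∀ n → length x ≡ n → Shape n → Outcome x (verdict n) (queriesAt n)
    go 0 eq (short _) = outcome-short x (≤-trans (≤-reflexive eq) z≤n)
    go 1 eq (short _) = outcome-short x (≤-trans (≤-reflexive eq) (s≤s z≤n))
    go 2 eq (short _) = outcome-short x (≤-reflexive eq)
    go (suc (suc (suc _))) eq (short (s≤s (s≤s ())))
    go _ eq (balanced m) rewrite half-double m   = outcome-odd m x eq
    go _ eq (lopsided m) rewrite half-double+1 m = outcome-even m x eq


  module _ {t : ℕ} {x : Word} (enough : 10 + 6 * length x ≤ t) where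

    private
      start : Config M
      start = initial M (bits x)

      concluded : Σ[ c ∈ Config M ] start ⟶⟨ t , queriesAt (length x) ⟩ c ×
                  current M c ≡ (if verdict (length x) then accept else reject)
      concluded with outcome x
      ... | _ , t≤ , c , r , eq = c , extend (≤-trans t≤ enough) r (halted (verdict (length x)) eq) , eq
        where
        halted : ∀ b → current M c ≡ (if b then accept else reject) → Halted M c
        halted true  = inj₁
        halted false = inj₂

      result : current M (run M X t start) ≡ (if verdict (length x) then accept else reject)
      result = trans (cong (current M) (_⟶⟨_,_⟩_.runs (proj₁ (proj₂ concluded)))) (proj₂ (proj₂ concluded))

    walker-queries : queriesFrom M X t start ≡ queriesAt (length x)
    walker-queries = _⟶⟨_,_⟩_.asks (proj₁ (proj₂ concluded))

    walker-halts : Halted M (run M X t start)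
    walker-halts with verdict (length x) | result
    ... | true  | acc = inj₁ acc
    ... | false | rej = inj₂ rej

    walker-accepts : Accepts M X (bits x) ⇔ T (verdict (length x))
    walker-accepts with verdict (length x) | result
    ... | true  | acc = mk⇔ (λ _ → tt) (λ _ → t , acc)
    ... | false | rej = mk⇔ (λ acc → case trans (sym rej) (accepts-halted {t} (inj₂ rej) acc) of λ ()) (λ ())

abstract
  timeBound : Polynomial
  timeBound = 10 ∷ 6 ∷ []

  timeBound-enough : ∀ n → 10 + 6 * n ≤ eval timeBound n
  timeBound-enough n = +-monoʳ-≤ 10 (≤-reflexive
    (trans (*-comm 6 n) (cong (λ k → n * (6 + k)) (sym (*-zeroʳ n)))))

walkerDPTM : Direction → DPTM
walkerDPTM D = record
  { machine = walker turn pad dir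
  ; bound   = timeBound
  ; halts   = λ X x → Walk.walker-halts D X {x = x} (timeBound-enough (length x))
  }
  where open Direction D

-- The downward and the upward direction

leadingBits-++ : ∀ {g} v w → leadingBits {g} (bits v ++ w) ≡ v ++ leadingBits w
leadingBits-++ []      w = refl
leadingBits-++ (b ∷ v) w = cong (b ∷_) (leadingBits-++ v w)

leadingBits-cells : ∀ {g} l w → leadingBits {g} (bits l ʳ++ w) ≡ l ʳ++ leadingBits w
leadingBits-cells []      w = refl
leadingBits-cells (b ∷ l) w = leadingBits-cells l (bit b ∷ w)

zeros-ʳ++ : ∀ k l → zeros k ʳ++ zeros l ≡ zeros (k + l)
zeros-ʳ++ zero    l = refl
zeros-ʳ++ (suc k) l = trans (zeros-ʳ++ k (suc l)) (cong zeros (+-suc k l))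

down up : Direction
down = record
  { turn = left ; dir = left ; pad = blank
  -- With `i` questions asked before and `j` still to follow. The last word, at `j = 0`, has length
  -- `3 + m`, one more than the leaf.
  ; position = λ m i j → suc j + suc (suc m)
  ; leafWord = λ m v → false ∷ v ++ [ true ]
  ; padded   = λ m i j → tape (bits (zeros (j + suc m))) (bit false) (replicate (suc i) blank)
  ; marked   = λ m j v → tape (bits (zeros j)) (bit false) (bits v ++ replicate (suc (suc m)) blank)
  ; final    = λ m v → tape [] (bit false) (bits v ++ replicate (suc (suc m)) blank)
  ; turned   = λ m → cong (λ k → tape (bits (zeros k)) (bit false) [ blank ]) (sym (cong suc (+-suc m m)))
  ; pad-step = λ m i j → refl
  ; pad-word = λ m i j → begin
      leadingBits (bits (zeros (suc j + suc m)) ʳ++ (bit false ∷ replicate (suc (suc i)) blank))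
        ≡⟨ leadingBits-cells (zeros (suc j + suc m)) _ ⟩
      zeros (suc j + suc m) ʳ++ zeros 1
        ≡⟨ zeros-ʳ++ (suc j + suc m) 1 ⟩
      zeros (suc j + suc m + 1)
        ≡⟨ cong zeros (trans (+-assoc (suc j) (suc m) 1) (cong (suc j +_) (+-comm (suc m) 1))) ⟩
      zeros (suc j + suc (suc m)) ∎
  ; padded-marked = λ m → refl
  ; mark-step     = λ m j b v → refl
  ; mark-last     = λ m v → refl
  ; mark-word     = λ m v → cong (false ∷_)
      (trans (leadingBits-++ (v ++ [ true ]) _) (List.++-identityʳ (v ++ [ true ])))
  }
  where open ≡-Reasoning
up = record
  { turn = stay ; dir = right ; pad = bit false
  ; position = λ m i j → inputLength m + suc i
  -- Writing proceeds to the right, so the padding comes first and the address appears reversed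
  -- behind it.
  ; leafWord = λ m v → reverse (false ∷ v ++ true ∷ zeros (inputLength m + suc m))
  ; padded   = λ m i j → tape (bits (zeros (inputLength m + i))) blank []
  ; marked   = λ m j v → tape (bits (v ++ zeros (inputLength m + suc m))) blank []
  ; final    = λ m v → tape (bits (false ∷ v ++ zeros (inputLength m + suc m))) blank []
  ; turned   = λ m → cong (λ k → tape (bits (zeros k)) blank []) (sym (+-identityʳ (inputLength m)))
  ; pad-step = λ m i j → cong (λ k → tape (bits (zeros k)) blank []) (sym (+-suc (inputLength m) i))
  ; pad-word = λ m i j → begin
      leadingBits (bits (zeros (inputLength m + suc i)) ʳ++ (blank ∷ []))
        ≡⟨ leadingBits-cells (zeros (inputLength m + suc i)) _ ⟩
      zeros (inputLength m + suc i) ʳ++ zeros 0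
        ≡⟨ zeros-ʳ++ (inputLength m + suc i) 0 ⟩
      zeros (inputLength m + suc i + 0)
        ≡⟨ cong zeros (+-identityʳ (inputLength m + suc i)) ⟩
      zeros (inputLength m + suc i) ∎
  ; padded-marked = λ m → refl
  ; mark-step     = λ m j b v → refl
  ; mark-last     = λ m v → refl
  ; mark-word     = λ m v → begin
      leadingBits (bits (false ∷ (v ++ [ true ]) ++ zeros (inputLength m + suc m)) ʳ++ (blank ∷ []))
        ≡⟨ leadingBits-cells (false ∷ (v ++ [ true ]) ++ zeros (inputLength m + suc m)) (blank ∷ []) ⟩
      reverse (false ∷ (v ++ [ true ]) ++ zeros (inputLength m + suc m))
        ≡⟨ cong (λ u → reverse (false ∷ u)) (List.++-assoc v [ true ] _) ⟩
      reverse (false ∷ v ++ true ∷ zeros (inputLength m + suc m)) ∎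
  }
  where open ≡-Reasoning

-- Enumeration of the machines up to extensional equality

-- Functions are compared extensionally, so enumerations are only asked to
-- reach every element up to a relation.
record Enumeration {A : Set} (_≈_ : A → A → Set) : Set where
  field
    enum    : ℕ → A
    reaches : ∀ a → Σ[ k ∈ ℕ ] enum k ≈ a

open Enumeration

-- Cantor's walk along the antidiagonals; from the end of one it jumps to the start of the following
-- one.
next : ℕ × ℕ → ℕ × ℕ
next (zero  , b) = suc b , zero
next (suc a , b) = a , suc b

unpair : ℕ → ℕ × ℕ
unpair zero    = 0 , 0
unpair (suc k) = next (unpair k)

unpair-reaches : ∀ a b → Σ[ k ∈ ℕ ] unpair k ≡ (a , b)
unpair-reaches a b = onDiagonal (a + b) a b refl
  where
  onDiagonal : ∀ s a b → a + b ≡ s → Σ[ k ∈ ℕ ] unpair k ≡ (a , b)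
  onDiagonal zero    zero zero eq = 0 , refl
  onDiagonal (suc s) (suc a) zero eq
    with k , e ← onDiagonal s zero a (suc-injective (trans (cong suc (sym (+-identityʳ a))) eq))
    = suc k , cong next e
  onDiagonal s a (suc b) eq
    with k , e ← onDiagonal s (suc a) b (trans (sym (+-suc a b)) eq)
    = suc k , cong next e

-- Compatibility of `f` with the relations is asked only around one chosen preimage of each `b`. So
-- `f` may ignore components of its argument, and the preimage may fill them with defaults.
mapEnum : ∀ {A B : Set} {_≈_ : A → A → Set} {_≋_ : B → B → Set} (f : A → B) →
  (∀ b → Σ[ a ∈ A ] (∀ {a′} → a′ ≈ a → f a′ ≋ b)) → Enumeration _≈_ → Enumeration _≋_
mapEnum f onto E .enum      = f ∘ enum E
mapEnum f onto E .reaches b with a , ok ← onto b with k , e ← reaches E a = k , ok e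

ℕ-enum : Enumeration {ℕ} _≡_
ℕ-enum .enum      = id
ℕ-enum .reaches n = n , refl

_⊗_ : ∀ {A B : Set} → (A → A → Set) → (B → B → Set) → A × B → A × B → Set
(R ⊗ S) (a , b) (a′ , b′) = R a a′ × S b b′

×-enum : ∀ {A B : Set} {_≈_ : A → A → Set} {_≋_ : B → B → Set} →
  Enumeration _≈_ → Enumeration _≋_ → Enumeration (_≈_ ⊗ _≋_)
×-enum E F .enum k = let (i , j) = unpair k in enum E i , enum F j
×-enum {_≈_ = _≈_} {_≋_} E F .reaches (a , b)
  with i , p ← reaches E a | j , q ← reaches F b
  with k , e ← unpair-reaches i j
  = k , subst (λ ij → (_≈_ ⊗ _≋_) (enum E (proj₁ ij) , enum F (proj₂ ij)) (a , b)) (sym e) (p , q)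

×-enum-≡ : ∀ {A B : Set} → Enumeration {A} _≡_ → Enumeration {B} _≡_ → Enumeration {A × B} _≡_
×-enum-≡ E F = mapEnum id (λ p → p , λ { (refl , refl) → refl }) (×-enum E F)

data Fibrewise {A : Set} {B : A → Set} (_≈_ : ∀ {a} → B a → B a → Set) :
  Σ[ a ∈ A ] B a → Σ[ a ∈ A ] B a → Set where
  fibre : ∀ {a} {b b′ : B a} → b ≈ b′ → Fibrewise _≈_ (a , b) (a , b′)

Σ-enum : ∀ {A : Set} {B : A → Set} {_≈_ : ∀ {a} → B a → B a → Set} →
  Enumeration {A} _≡_ → (∀ a → Enumeration (_≈_ {a})) → Enumeration (Fibrewise {A} {B} _≈_)
Σ-enum E F .enum k = let (i , j) = unpair k in enum E i , enum (F (enum E i)) j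
Σ-enum {_≈_ = _≈_} E F .reaches (a , b)
  with i , refl ← reaches E a with j , q ← reaches (F a) b with k , e ← unpair-reaches i j
  = k , subst (λ ij → Fibrewise _≈_ (enum E (proj₁ ij) , enum (F (enum E (proj₁ ij))) (proj₂ ij)) (a , b))
          (sym e) (fibre q)

clip : ∀ n → ℕ → Fin (suc n)
clip n       zero    = Fin.zero
clip zero    (suc k) = Fin.zero
clip (suc n) (suc k) = Fin.suc (clip n k)

clip-toℕ : ∀ n (i : Fin (suc n)) → clip n (Fin.toℕ i) ≡ i
clip-toℕ n       Fin.zero    = refl
clip-toℕ (suc n) (Fin.suc i) = cong Fin.suc (clip-toℕ n i)

Fin-enum : ∀ n → Enumeration {Fin (suc n)} _≡_
Fin-enum n .enum      = clip n
Fin-enum n .reaches i = Fin.toℕ i , clip-toℕ n i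

Pointwise : ∀ {A B : Set} → (B → B → Set) → (A → B) → (A → B) → Set
Pointwise _≈_ f g = ∀ a → f a ≈ g a

Fin→-enum : ∀ {B : Set} {_≈_ : B → B → Set} → Enumeration _≈_ → ∀ n → Enumeration (Pointwise {Fin n} _≈_)
Fin→-enum E zero .enum      _ ()
Fin→-enum E zero .reaches f = 0 , λ ()
Fin→-enum E (suc n) = mapEnum
  (λ { (b , f) Fin.zero → b ; (b , f) (Fin.suc i) → f i })
  (λ f → (f Fin.zero , f ∘ Fin.suc) , λ { (p , q) Fin.zero → p ; (p , q) (Fin.suc i) → q i })
  (×-enum E (Fin→-enum E n))

private variable g : ℕ

symbolIndex : Symbol g → Fin (4 + g)
symbolIndex blank       = Fin.zero
symbolIndex (bit false) = Fin.suc Fin.zero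
symbolIndex (bit true)  = Fin.suc (Fin.suc Fin.zero)
symbolIndex comma       = Fin.suc (Fin.suc (Fin.suc Fin.zero))
symbolIndex (aux i)     = Fin.suc (Fin.suc (Fin.suc (Fin.suc i)))

indexedSymbol : Fin (4 + g) → Symbol g
indexedSymbol Fin.zero                                  = blank
indexedSymbol (Fin.suc Fin.zero)                        = bit false
indexedSymbol (Fin.suc (Fin.suc Fin.zero))              = bit true
indexedSymbol (Fin.suc (Fin.suc (Fin.suc Fin.zero)))    = comma
indexedSymbol (Fin.suc (Fin.suc (Fin.suc (Fin.suc i)))) = aux i

indexedSymbol-symbolIndex : (s : Symbol g) → indexedSymbol (symbolIndex s) ≡ s
indexedSymbol-symbolIndex blank       = refl
indexedSymbol-symbolIndex (bit false) = refl
indexedSymbol-symbolIndex (bit true)  = refl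
indexedSymbol-symbolIndex comma       = refl
indexedSymbol-symbolIndex (aux i)     = refl

Symbol-enum : Enumeration {Symbol g} _≡_
Symbol-enum {g} = mapEnum indexedSymbol
  (λ s → symbolIndex s , λ { refl → indexedSymbol-symbolIndex s }) (Fin-enum (3 + g))

Move-enum : Enumeration {Move} _≡_
Move-enum = mapEnum
  (λ { Fin.zero → left ; (Fin.suc Fin.zero) → stay ; (Fin.suc (Fin.suc _)) → right })
  (λ { left  → Fin.zero , λ { refl → refl }
     ; stay  → Fin.suc Fin.zero , λ { refl → refl }
     ; right → Fin.suc (Fin.suc Fin.zero) , λ { refl → refl } })
  (Fin-enum 2)

Vec-enum : ∀ {A : Set} → Enumeration {A} _≡_ → ∀ n → Enumeration {Vec A n} _≡_
Vec-enum E zero .enum       _  = []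
Vec-enum E zero .reaches    [] = 0 , refl
Vec-enum E (suc n) = mapEnum (uncurry _∷_)
  (λ { (a ∷ as) → (a , as) , λ { (refl , refl) → refl } }) (×-enum E (Vec-enum E n))

Symbol→-enum : ∀ {B : Set} {_≈_ : B → B → Set} → Enumeration _≈_ → Enumeration (Pointwise {Symbol g} _≈_)
Symbol→-enum {g} {_≈_ = _≈_} E = mapEnum (_∘ symbolIndex)
  (λ f → f ∘ indexedSymbol , λ {h} e s →
    subst (λ s′ → h (symbolIndex s) ≈ f s′) (indexedSymbol-symbolIndex s) (e (symbolIndex s)))
  (Fin→-enum E (4 + g))

Symbols→-enum : ∀ {B : Set} {_≈_ : B → B → Set} → Enumeration _≈_ → ∀ n →
  Enumeration (Pointwise {Vec (Symbol g) n} _≈_)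
Symbols→-enum E zero = mapEnum (λ b → λ { [] → b }) (λ f → f [] , λ { e [] → e }) E
Symbols→-enum E (suc n) = mapEnum (λ { f (s ∷ v) → f s v })
  (λ f → (λ s v → f (s ∷ v)) , λ { e (s ∷ v) → e s v })
  (Symbol→-enum (Symbols→-enum E n))

module _ {s t g : ℕ} where

  data _≈ᴵ_ : Instruction s t g → Instruction s t g → Set where
    accept : accept ≈ᴵ accept
    reject : reject ≈ᴵ reject
    ask    : ∀ {y n} → ask y n ≈ᴵ ask y n
    act    : ∀ {δ δ′} → Pointwise _≡_ δ δ′ → act δ ≈ᴵ act δ′

-- The leading tag selects the component that is read; the preimages fill the others with default
-- values.
Instruction-enum : ∀ s t g → Enumeration (_≈ᴵ_ {suc s} {t} {g})
Instruction-enum s t g = mapEnum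
  (λ { (Fin.zero , _) → accept
     ; (Fin.suc Fin.zero , _) → reject
     ; (Fin.suc (Fin.suc Fin.zero) , (y , n) , _) → ask y n
     ; (Fin.suc (Fin.suc (Fin.suc _)) , _ , δ) → act δ })
  (λ { accept    → (Fin.zero , (Fin.zero , Fin.zero) , idle) , λ { (refl , _) → accept }
     ; reject    → (Fin.suc Fin.zero , (Fin.zero , Fin.zero) , idle) , λ { (refl , _) → reject }
     ; (ask y n) → (Fin.suc (Fin.suc Fin.zero) , (y , n) , idle) , λ { (refl , refl , _) → ask }
     ; (act δ)   → (Fin.suc (Fin.suc (Fin.suc Fin.zero)) , (Fin.zero , Fin.zero) , δ) ,
                   λ { (refl , _ , e) → act e } })
  (×-enum (Fin-enum 3)
    (×-enum (×-enum-≡ (Fin-enum s) (Fin-enum s))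
      (Symbols→-enum (×-enum-≡ (Fin-enum s) (Vec-enum (×-enum-≡ Symbol-enum Move-enum) t)) t)))
  where
  idle : Vec (Symbol g) t → Fin (suc s) × Vec (Symbol g × Move) t
  idle _ = Fin.zero , Vec.replicate t (blank , stay)

Polynomial-enum : Enumeration {Polynomial} _≡_
Polynomial-enum = mapEnum (λ { (n , f) → tabulate f })
  (λ p → (length p , lookup p) ,
    λ { (fibre e) → trans (List.tabulate-cong e) (List.tabulate-lookup p) })
  (Σ-enum ℕ-enum (Fin→-enum ℕ-enum))

-- Machines compared by their behaviour

accepting : ∀ {s t g} → Instruction s t g → Bool
accepting accept = true
accepting _      = false

accepting-cong : ∀ {s t g} {i j : Instruction s t g} → i ≈ᴵ j → accepting i ≡ accepting j
accepting-cong accept  = refl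
accepting-cong reject  = refl
accepting-cong ask     = refl
accepting-cong (act _) = refl

-- With the instruction as an argument, the steps of two machines whose programs are merely related
-- can be compared by cases on `_≈ᴵ_`.
stepBy : (M : Machine) → Language →
  Instruction (Machine.states M) (Machine.tapes M) (Machine.g M) → Config M → Config M
stepBy M X accept    c             = c
stepBy M X reject    c             = c
stepBy M X (ask y n) c             = config (if X (queryWord M c) then y else n) (Config.contents c)
stepBy M X (act δ)   (config q ts) =
  let (q′ , ws) = δ (Vec.map Tape.head ts) in config q′ (Vec.zipWith write ts ws)

step-stepBy : ∀ M X c → step M X c ≡ stepBy M X (current M c) c
step-stepBy M X (config q ts) with Machine.program M q
... | accept = refl
... | reject = refl
... | act δ  = refl
... | ask y n with X (queryWord M (config q ts))
...   | true  = refl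
...   | false = refl

acceptsWithin : Machine → ℕ → Word → Bool
acceptsWithin M t w = accepting (current M (run M ∅ t (initial M (bits w))))

outputAfter : Machine → ℕ → Word → Word
outputAfter M t w = leadingBits (outputWord M (run M ∅ t (initial M (bits w))))

-- Exactly what a stage observes of a candidate: acceptance and output bits after a given number of
-- steps with the empty oracle.
_≈ᴹ_ : Machine → Machine → Set
M ≈ᴹ N = ∀ t w → acceptsWithin M t w ≡ acceptsWithin N t w × outputAfter M t w ≡ outputAfter N t w

Frame : Set
Frame = ℕ × ℕ × ℕ

Body : Frame → Set
Body (s , t , g) =
  Fin (suc s) × (Fin (suc t) × Fin (suc t) × Fin (suc t)) ×
  (Fin (suc s) → Instruction (suc s) (suc t) g)

assemble : Σ[ f ∈ Frame ] Body f → Machine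
assemble ((s , t , g) , q , (i , o , r) , p) = record
  { states = suc s ; tapes = suc t ; g = g ; start = q ; input = i ; query = r ; output = o ; program = p }

_≈ᴮ_ : ∀ {f} → Body f → Body f → Set
_≈ᴮ_ = _≡_ ⊗ (_≡_ ⊗ Pointwise _≈ᴵ_)

module _ {s t g : ℕ} (q : Fin (suc s)) (h : Fin (suc t) × Fin (suc t) × Fin (suc t))
         {p p′ : Fin (suc s) → Instruction (suc s) (suc t) g} (p≈p′ : Pointwise _≈ᴵ_ p p′) where

  private
    M N : Machine
    M = assemble ((s , t , g) , q , h , p)
    N = assemble ((s , t , g) , q , h , p′)

    -- `Config` is indexed by the machine, but its fields depend only on the numbers of states,
    -- tapes and symbols, which `M` and `N` share.
    recast : Config M → Config N
    recast (config q ts) = config q ts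

    stepBy-recast : ∀ {i j} → i ≈ᴵ j → ∀ c → recast (stepBy M ∅ i c) ≡ stepBy N ∅ j (recast c)
    stepBy-recast accept  c = refl
    stepBy-recast reject  c = refl
    stepBy-recast ask     c = refl
    stepBy-recast (act e) c rewrite e (Vec.map Tape.head (Config.contents c)) = refl

    step-recast : ∀ c → recast (step M ∅ c) ≡ step N ∅ (recast c)
    step-recast c = trans (cong recast (step-stepBy M ∅ c))
      (trans (stepBy-recast (p≈p′ (Config.state c)) c) (sym (step-stepBy N ∅ (recast c))))

    run-recast : ∀ k c → recast (run M ∅ k c) ≡ run N ∅ k (recast c)
    run-recast zero    c = refl
    run-recast (suc k) c = trans (run-recast k (step M ∅ c)) (cong (run N ∅ k) (step-recast c))

  program-cong : M ≈ᴹ N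
  program-cong k w =
    trans (accepting-cong (p≈p′ _)) (cong (accepting ∘ current N) (run-recast k _)) ,
    cong (λ c → leadingBits (outputWord N c)) (run-recast k _)

Machine-enum : Enumeration _≈ᴹ_
Machine-enum = mapEnum assemble
  (λ M → disassemble M , assembled M)
  (Σ-enum {_≈_ = _≈ᴮ_}
    (×-enum-≡ ℕ-enum (×-enum-≡ ℕ-enum ℕ-enum))
    (λ (s , t , g) → ×-enum (Fin-enum s) (×-enum (×-enum-≡ (Fin-enum t) (×-enum-≡ (Fin-enum t) (Fin-enum t)))
      (Fin→-enum (Instruction-enum s (suc t) g) (suc s)))))
  where
  disassemble : Machine → Σ[ f ∈ Frame ] Body f
  disassemble record { states = suc s ; tapes = suc t ; g = g ; start = q
                     ; input = i ; query = r ; output = o ; program = p } =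
    (s , t , g) , q , (i , o , r) , p
  disassemble record { states = suc _ ; tapes = zero ; input = () }
  disassemble record { states = zero ; start = () }

  assembled : ∀ M {a} → Fibrewise _≈ᴮ_ a (disassemble M) → assemble a ≈ᴹ M
  assembled record { states = suc s ; tapes = suc t ; g = g ; start = q
                   ; input = i ; query = r ; output = o ; program = p }
    (fibre (refl , refl , e)) = program-cong q (i , o , r) e
  assembled record { states = suc _ ; tapes = zero ; input = () }
  assembled record { states = zero ; start = () }

-- The evaluator of a truth-table reduction with its time bound, and the generator of the queries
-- with its own.
Candidate : Set
Candidate = (Machine × Polynomial) × (Machine × Polynomial)

abstract
  Candidate-enum : Enumeration {Candidate} ((_≈ᴹ_ ⊗ _≡_) ⊗ (_≈ᴹ_ ⊗ _≡_))
  Candidate-enum = ×-enum (×-enum Machine-enum Polynomial-enum) (×-enum Machine-enum Polynomial-enum)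

-- Polynomial bounds

-- A single power, so that the bound turns into a power of two once `c + n` is one.
PolynomiallyBounded : (ℕ → ℕ) → Set
PolynomiallyBounded f = Σ[ c ∈ ℕ ] Σ[ d ∈ ℕ ] ∀ n → f n < (c + n) ^ d

private variable f h : ℕ → ℕ

const-bounded : ∀ a → PolynomiallyBounded (λ _ → a)
const-bounded a = suc a , 1 , λ n → ≤-trans (m≤m+n (suc a) n) (≤-reflexive (sym (*-identityʳ _)))

id-bounded : PolynomiallyBounded id
id-bounded = 1 , 1 , λ n → ≤-reflexive (sym (*-identityʳ (suc n)))

-- The product of the two successors dominates both the sum and the product of `f` and `h`, so one
-- estimate yields both closure properties.
suc*suc-bounded : PolynomiallyBounded f → PolynomiallyBounded h →
  Σ[ c ∈ ℕ ] Σ[ d ∈ ℕ ] ∀ n → suc (f n) * suc (h n) ≤ (c + n) ^ d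
suc*suc-bounded {f} {h} (c , d , f<) (c′ , d′ , h<) = c + c′ , d + d′ , λ n → begin
  suc (f n) * suc (h n)               ≤⟨ *-mono-≤ (f< n) (h< n) ⟩
  (c + n) ^ d * (c′ + n) ^ d′         ≤⟨ *-mono-≤ (^-monoˡ-≤ d (+-monoˡ-≤ n (m≤m+n c c′)))
                                                  (^-monoˡ-≤ d′ (+-monoˡ-≤ n (m≤n+m c′ c))) ⟩
  (c + c′ + n) ^ d * (c + c′ + n) ^ d′ ≡⟨ ^-distribˡ-+-* (c + c′ + n) d d′ ⟨
  (c + c′ + n) ^ (d + d′)             ∎
  where open ≤-Reasoning

+-bounded : PolynomiallyBounded f → PolynomiallyBounded h → PolynomiallyBounded (λ n → f n + h n)
+-bounded {f} {h} F H with c , d , le ← suc*suc-bounded F H = c , d , λ n → begin-strict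
  f n + h n               ≡⟨ +-comm (f n) (h n) ⟩
  h n + f n               <⟨ s≤s (+-monoʳ-≤ (h n) (m≤m*n (f n) (suc (h n)))) ⟩
  suc (f n) * suc (h n)   ≤⟨ le n ⟩
  (c + n) ^ d             ∎
  where open ≤-Reasoning

*-bounded : PolynomiallyBounded f → PolynomiallyBounded h → PolynomiallyBounded (λ n → f n * h n)
*-bounded {f} {h} F H with c , d , le ← suc*suc-bounded F H = c , d , λ n → begin-strict
  f n * h n               <⟨ s≤s (≤-trans (*-monoʳ-≤ (f n) (n≤1+n (h n))) (m≤n+m _ (h n))) ⟩
  suc (f n) * suc (h n)   ≤⟨ le n ⟩
  (c + n) ^ d             ∎
  where open ≤-Reasoning

eval-bounded : ∀ p → PolynomiallyBounded f → PolynomiallyBounded (λ n → eval p (f n))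
eval-bounded []      F = const-bounded 0
eval-bounded (a ∷ p) F = +-bounded (const-bounded a) (*-bounded F (eval-bounded p F))

eval-mono : ∀ p {m n} → m ≤ n → eval p m ≤ eval p n
eval-mono []      m≤n = z≤n
eval-mono (a ∷ p) m≤n = +-monoʳ-≤ a (*-mono-≤ m≤n (eval-mono p m≤n))

n<2^n : ∀ n → n < 2 ^ n
n<2^n zero    = s≤s z≤n
n<2^n (suc n) = begin-strict
  suc n           ≤⟨ n<2^n n ⟩
  2 ^ n           <⟨ m<m+n (2 ^ n) (m^n>0 2 n) ⟩
  2 ^ n + 2 ^ n   ≡⟨ cong (2 ^ n +_) (+-identityʳ (2 ^ n)) ⟨
  2 ^ suc n       ∎
  where open ≤-Reasoning

-- Squaring `i < 2 ^ i`: for `i = a + a + b` the linear term is at most `i * i + i`, which is below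
-- `suc i * suc i`.
linear<2^ : ∀ a b → Σ[ j ∈ ℕ ] a * j + b < 2 ^ j
linear<2^ a b = i + i , (begin-strict
  a * (i + i) + b             ≤⟨ +-monoʳ-≤ (a * (i + i)) (m≤n+m b (a + a)) ⟩
  a * (i + i) + i             ≡⟨ cong (_+ i) (trans (*-distribˡ-+ a i i) (sym (*-distribʳ-+ i a a))) ⟩
  (a + a) * i + i             ≤⟨ +-monoˡ-≤ i (*-monoˡ-≤ i (m≤m+n (a + a) b)) ⟩
  i * i + i                   <⟨ s≤s (≤-trans (≤-reflexive (trans (+-comm (i * i) i) (sym (*-suc i i))))
                                             (m≤n+m (i * suc i) i)) ⟩
  suc i * suc i               ≤⟨ *-mono-≤ (n<2^n i) (n<2^n i) ⟩
  2 ^ i * 2 ^ i               ≡⟨ ^-distribˡ-+-* 2 i i ⟨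
  2 ^ (i + i)                 ∎)
  where
  open ≤-Reasoning
  i = a + a + b

-- With c + m = 2 ^ j the bound (c + m) ^ d = 2 ^ (j d) is compared through the exponents.
eventually<2^ : PolynomiallyBounded f → ∀ N → Σ[ m ∈ ℕ ] N ≤ m × f m < 2 ^ m
eventually<2^ {f} (c , d , f<) N with j , le ← linear<2^ d (c + N) = m , N≤m , (begin-strict
  f m             <⟨ f< m ⟩
  (c + m) ^ d     ≡⟨ cong (_^ d) (m+[n∸m]≡n c≤) ⟩
  (2 ^ j) ^ d     ≡⟨ ^-*-assoc 2 j d ⟩
  2 ^ (j * d)     ≤⟨ ^-monoʳ-≤ 2 jd≤m ⟩
  2 ^ m           ∎)
  where
  open ≤-Reasoning
  m = 2 ^ j ∸ c

  shifted : d * j + N + c ≤ 2 ^ j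
  shifted = ≤-trans (≤-reflexive (trans (+-assoc (d * j) N c) (cong (d * j +_) (+-comm N c)))) (<⇒≤ le)

  c≤ : c ≤ 2 ^ j
  c≤ = ≤-trans (m≤n+m c (d * j + N)) shifted

  both : d * j + N ≤ m
  both = m+n≤o⇒m≤o∸n (d * j + N) shifted

  N≤m : N ≤ m
  N≤m = ≤-trans (m≤n+m N (d * j)) both

  jd≤m : j * d ≤ m
  jd≤m = ≤-trans (≤-reflexive (*-comm j d)) (≤-trans (m≤m+n (d * j) N) both)

-- Growth of tapes, length of outputs and decoding of tuples

size : ∀ {g} → Tape g → ℕ
size t = length (cells t)

size-tape : ∀ l (a : Symbol g) r → size (tape l a r) ≡ length l + suc (length r)
size-tape l a r = List.length-ʳ++ l

size-move : ∀ d (t : Tape g) → size (move d t) ≤ suc (size t)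
size-move left  (tape []      a r)       = n≤1+n _
size-move left  (tape (b ∷ l) a r)       = n≤1+n _
size-move stay  t                        = n≤1+n _
size-move right (tape l       a [])      = ≤-reflexive (begin
  size (tape (a ∷ l) blank [])  ≡⟨ size-tape (a ∷ l) blank [] ⟩
  suc (length l + 1)            ≡⟨ cong suc (size-tape l a []) ⟨
  suc (size (tape l a []))      ∎)
  where open ≡-Reasoning
size-move right (tape l       a (b ∷ r)) = n≤1+n _

size-write : ∀ (t : Tape g) w → size (write t w) ≤ suc (size t)
size-write (tape l b r) (a , m) = ≤-trans (size-move m (tape l a r))
  (s≤s (≤-reflexive (trans (size-tape l a r) (sym (size-tape l b r)))))

size-step : ∀ M X c i →
  size (Vec.lookup (Config.contents (step M X c)) i) ≤ suc (size (Vec.lookup (Config.contents c) i))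
size-step M X c i rewrite step-stepBy M X c = by (current M c) c
  where
  by : ∀ j c →
    size (Vec.lookup (Config.contents (stepBy M X j c)) i) ≤ suc (size (Vec.lookup (Config.contents c) i))
  by accept    c = n≤1+n _
  by reject    c = n≤1+n _
  by (ask y n) c = n≤1+n _
  by (act δ) (config q ts) = ≤-trans
    (≤-reflexive (cong size (Vec.lookup-zipWith write i ts ws)))
    (size-write (Vec.lookup ts i) (Vec.lookup ws i))
    where ws = proj₂ (δ (Vec.map Tape.head ts))

size-run : ∀ M X t c i →
  size (Vec.lookup (Config.contents (run M X t c)) i) ≤ t + size (Vec.lookup (Config.contents c) i)
size-run M X zero    c i = ≤-refl
size-run M X (suc t) c i = begin
  size (Vec.lookup (Config.contents (run M X t (step M X c))) i) ≤⟨ size-run M X t (step M X c) i ⟩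
  t + size (Vec.lookup (Config.contents (step M X c)) i)         ≤⟨ +-monoʳ-≤ t (size-step M X c i) ⟩
  t + suc (size (Vec.lookup (Config.contents c) i))              ≡⟨ +-suc t _ ⟩
  suc t + size (Vec.lookup (Config.contents c) i)                ∎
  where open ≤-Reasoning

size-load : (w : List (Symbol g)) → size (load w) ≤ suc (length w)
size-load []      = ≤-refl
size-load (a ∷ w) = n≤1+n _

size-loaded : ∀ {k} (i j : Fin k) (w : List (Symbol g)) →
  size (Vec.lookup (Vec.replicate k (load []) Vec.[ i ]≔ load w) j) ≤ suc (length w)
size-loaded Fin.zero    Fin.zero    w = size-load w
size-loaded Fin.zero    (Fin.suc j) w =
  ≤-trans (≤-reflexive (cong size (Vec.lookup-replicate j (load [])))) (s≤s z≤n)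
size-loaded (Fin.suc i) Fin.zero    w = s≤s z≤n
size-loaded (Fin.suc i) (Fin.suc j) w = size-loaded i j w

length-untilBlank : (w : List (Symbol g)) → length (untilBlank w) ≤ length w
length-untilBlank []          = z≤n
length-untilBlank (blank ∷ w) = z≤n
length-untilBlank (bit _ ∷ w) = s≤s (length-untilBlank w)
length-untilBlank (comma ∷ w) = s≤s (length-untilBlank w)
length-untilBlank (aux _ ∷ w) = s≤s (length-untilBlank w)

-- A step adds at most one cell to a tape; the extra `suc` accounts for the cell that an empty tape
-- has under its head.
length-outputWord : ∀ M X t w →
  length (outputWord M (run M X t (initial M w))) ≤ t + suc (length w)
length-outputWord M X t w = begin
  length (outputWord M (run M X t (initial M w)))
    ≤⟨ length-untilBlank (cells (Vec.lookup (Config.contents (run M X t (initial M w))) output)) ⟩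
  size (Vec.lookup (Config.contents (run M X t (initial M w))) output)
    ≤⟨ size-run M X t (initial M w) output ⟩
  t + size (Vec.lookup (Config.contents (initial M w)) output)
    ≤⟨ +-monoʳ-≤ t (size-loaded input output w) ⟩
  t + suc (length w) ∎
  where
  open ≤-Reasoning
  open Machine M

-- Each component, even an empty one, leaves its comma on the tape.
length-tuple : (ws : List Word) → length ws ≤ length (tuple {g} ws)
length-tuple [] = z≤n
length-tuple {g} (w ∷ ws) = begin
  suc (length ws)                                     ≤⟨ s≤s (length-tuple {g} ws) ⟩
  1 + length (tuple {g} ws)                           ≤⟨ +-monoˡ-≤ _ (m≤n+m 1 (length (bits {g} w))) ⟩
  length (bits {g} w) + 1 + length (tuple {g} ws)     ≡⟨ cong (_+ length (tuple {g} ws)) (List.length-++ (bits w)) ⟨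
  length (bits {g} w ++ [ comma ]) + length (tuple {g} ws) ≡⟨ List.length-++ (bits w ++ [ comma ]) ⟨
  length (tuple {g} (w ∷ ws))                         ∎
  where open ≤-Reasoning

prefixed : Bool → List Word → List Word
prefixed b []       = [ b ∷ [] ]
prefixed b (w ∷ ws) = (b ∷ w) ∷ ws

-- Made total because a stage applies it to whatever the inverting machine leaves behind for an
-- arbitrary candidate.
untuple : List (Symbol g) → List Word
untuple []          = []
untuple (bit b ∷ s) = prefixed b (untuple s)
untuple (comma ∷ s) = [] ∷ untuple s
untuple (_ ∷ s)     = []

untuple-tuple : ∀ ws → untuple (tuple {g} ws) ≡ ws
untuple-tuple [] = refl
untuple-tuple {g} (w ∷ ws) = trans (cong untuple (List.++-assoc (bits w) [ comma ] (tuple ws))) (entry w)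
  where
  entry : ∀ w → untuple (bits {g} w ++ comma ∷ tuple ws) ≡ w ∷ ws
  entry []      = cong ([] ∷_) (untuple-tuple ws)
  entry (b ∷ w) = cong (prefixed b) (entry w)

open Direction

-- Oracles made of sparse zones

_≟ʷ_ = List.≡-dec Bool._≟_

leafDown leafUp : ℕ → Word → Word
leafDown = leafWord down
leafUp   = leafWord up

length-leafDown : ∀ m v → length v ≡ m → length (leafDown m v) ≡ 2 + m
length-leafDown m v eq = cong suc (trans (List.length-++ v) (trans (+-comm (length v) 1) (cong suc eq)))

length-leafUp : ∀ m v → length v ≡ m → length (leafUp m v) ≡ 6 + 4 * m
length-leafUp m v refl = begin
  length (leafUp m v)
    ≡⟨ List.length-reverse (false ∷ v ++ true ∷ zeros (inputLength m + suc m)) ⟩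
  suc (length (v ++ true ∷ zeros (inputLength m + suc m)))
    ≡⟨ cong suc (List.length-++ v) ⟩
  suc (m + suc (length (zeros (inputLength m + suc m))))
    ≡⟨ cong (λ k → suc (m + suc k)) (List.length-replicate (inputLength m + suc m)) ⟩
  suc (m + suc (inputLength m + suc m))
    ≡⟨ solve 1 (λ m →
         con 1 :+ (m :+ (con 1 :+ ((con 3 :+ (m :+ m)) :+ (con 1 :+ m)))) := con 6 :+ con 4 :* m) refl m ⟩
  6 + 4 * m ∎
  where
  open ≡-Reasoning
  open +-*-Solver

-- The last bits differ, hence the first bits of the reversed words.
leafDown≢leafUp : ∀ m v n w → leafDown m v ≢ leafUp n w
leafDown≢leafUp m v n w eq = case trans (sym (List.reverse-++ (false ∷ v) [ true ]))
  (trans (cong reverse eq) (List.reverse-involutive (false ∷ w ++ true ∷ zeros (inputLength n + suc n)))) of λ ()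

isZero : Word → Bool
isZero []          = true
isZero (true ∷ u)  = false
isZero (false ∷ u) = isZero u

isZero-zeros : ∀ k → isZero (zeros k) ≡ true
isZero-zeros zero    = refl
isZero-zeros (suc k) = isZero-zeros k

isZero-ʳ++ : ∀ u {w} → isZero w ≡ false → isZero (u ʳ++ w) ≡ false
isZero-ʳ++ []          eq = eq
isZero-ʳ++ (true ∷ u)  eq = isZero-ʳ++ u refl
isZero-ʳ++ (false ∷ u) eq = isZero-ʳ++ u eq

isZero-leafDown : ∀ m v → isZero (leafDown m v) ≡ false
isZero-leafDown m []          = refl
isZero-leafDown m (true ∷ v)  = refl
isZero-leafDown m (false ∷ v) = isZero-leafDown m v

isZero-leafUp : ∀ m v → isZero (leafUp m v) ≡ false
isZero-leafUp m v = behind v [ false ]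
  where
  behind : ∀ v w → isZero ((v ++ true ∷ zeros (inputLength m + suc m)) ʳ++ w) ≡ false
  behind []      w = isZero-ʳ++ (zeros (inputLength m + suc m)) refl
  behind (b ∷ v) w = behind v (b ∷ w)

digit : Word → ℕ → Bool
digit []      i       = false
digit (b ∷ w) zero    = b
digit (b ∷ w) (suc i) = digit w i

digit-< : ∀ w i → digit w i ≡ true → i < length w
digit-< (b ∷ w) zero    eq = s≤s z≤n
digit-< (b ∷ w) (suc i) eq = s≤s (digit-< w i eq)

digit-++ : ∀ p b s → digit (p ++ b ∷ s) (length p) ≡ b
digit-++ []      b s = refl
digit-++ (_ ∷ p) b s = digit-++ p b s

-- The part of the oracle used by the walks on inputs of length 3 + 2m: both
-- walks find the address w on unary words, and the answer b at the leaf w.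
record Zone : Set where
  constructor zone
  field
    m    : ℕ
    w    : Word
    b    : Bool
    fits : length w ≡ m

-- Inverts both `position` functions. At `ℓ = inputLength m` truncated subtraction yields 0, but no
-- walk on inputs of that length asks a word of the same length. Indices outside the address give
-- `false` under `digit`, which keeps a zone finite.
digitIndex : ℕ → ℕ → ℕ
digitIndex m ℓ = if does (ℓ <? inputLength m) then (2 + (m + m)) ∸ ℓ else ℓ ∸ suc (inputLength m)

-- Unary words carry the address and other words carry the answer; every leaf contains a `true`, so
-- the two do not interfere.
inZone : ℕ → Word → Bool → Language
inZone m w b u =
  if isZero u then digit w (digitIndex m (length u))
              else b ∧ (does (u ≟ʷ leafDown m w) ∨ does (u ≟ʷ leafUp m w))

members : Zone → Language
members (zone m w b _) = inZone m w b

inZone-leaf : ∀ m w b u → isZero u ≡ false → inZone m w b u ≡ true → u ≡ leafDown m w ⊎ u ≡ leafUp m w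
inZone-leaf m w b u nz eq with isZero u
inZone-leaf m w true u nz eq | false with u ≟ʷ leafDown m w | u ≟ʷ leafUp m w
... | yes p | _     = inj₁ p
... | no  _ | yes q = inj₂ q

inZone-zero : ∀ m w b u → isZero u ≡ true → inZone m w b u ≡ true → digit w (digitIndex m (length u)) ≡ true
inZone-zero m w b u z eq with isZero u
inZone-zero m w b u z eq | true = eq

inZone-leafDown : ∀ m w b → inZone m w b (leafDown m w) ≡ b
inZone-leafDown m w b
  rewrite isZero-leafDown m w | dec-true (leafDown m w ≟ʷ leafDown m w) refl = Bool.∧-identityʳ b

inZone-leafUp : ∀ m w b → inZone m w b (leafUp m w) ≡ b
inZone-leafUp m w b
  rewrite isZero-leafUp m w | dec-true (leafUp m w ≟ʷ leafUp m w) refl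
        | Bool.∨-zeroʳ (does (leafUp m w ≟ʷ leafDown m w)) = Bool.∧-identityʳ b

-- This is what allows `b` to be fixed after the queries of a stage are known.
inZone-elsewhere : ∀ m w b b′ u → u ≢ leafDown m w → u ≢ leafUp m w → inZone m w b u ≡ inZone m w b′ u
inZone-elsewhere m w b b′ u ≢d ≢u
  rewrite dec-false (u ≟ʷ leafDown m w) ≢d | dec-false (u ≟ʷ leafUp m w) ≢u
        | Bool.∧-zeroʳ b | Bool.∧-zeroʳ b′ = refl

InRange : ℕ → ℕ → Set
InRange m ℓ = 2 + m ≤ ℓ × ℓ ≤ 6 + 4 * m

digitIndex-range : ∀ m ℓ → digitIndex m ℓ < m → InRange m ℓ
digitIndex-range m ℓ i< with ℓ <? inputLength m
... | yes ℓ<n rewrite dec-true (ℓ <? inputLength m) ℓ<n = lower , upper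
  where
  open ≤-Reasoning
  lower : 2 + m ≤ ℓ
  lower = +-cancelˡ-≤ m (2 + m) ℓ (begin
    m + (2 + m)                    ≡⟨ +-comm m (2 + m) ⟩
    2 + (m + m)                    ≤⟨ m≤n+m∸n (2 + (m + m)) ℓ ⟩
    ℓ + ((2 + (m + m)) ∸ ℓ)        ≤⟨ +-monoʳ-≤ ℓ (<⇒≤ i<) ⟩
    ℓ + m                          ≡⟨ +-comm ℓ m ⟩
    m + ℓ                          ∎)
  upper : ℓ ≤ 6 + 4 * m
  upper = begin
    ℓ                ≤⟨ <⇒≤ ℓ<n ⟩
    3 + (m + m)      ≤⟨ +-mono-≤ (m≤m+n 3 3) (+-monoʳ-≤ m (m≤m+n m _)) ⟩
    6 + 4 * m        ∎
... | no ℓ≮n rewrite dec-false (ℓ <? inputLength m) ℓ≮n = lower , upper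
  where
  open ≤-Reasoning
  lower : 2 + m ≤ ℓ
  lower = begin
    2 + m            ≤⟨ +-mono-≤ (m≤m+n 2 1) (m≤m+n m m) ⟩
    3 + (m + m)      ≤⟨ ≮⇒≥ ℓ≮n ⟩
    ℓ                ∎
  upper : ℓ ≤ 6 + 4 * m
  upper = begin
    ℓ                                               ≤⟨ m≤n+m∸n ℓ (suc (inputLength m)) ⟩
    suc (inputLength m) + (ℓ ∸ suc (inputLength m)) ≤⟨ +-monoʳ-≤ (suc (inputLength m)) (<⇒≤ i<) ⟩
    4 + ((m + m) + m)                               ≤⟨ +-mono-≤ (m≤m+n 4 2) (≤-trans (≤-reflexive (+-assoc m m m))
                                                         (+-monoʳ-≤ m (+-monoʳ-≤ m (m≤m+n m _)))) ⟩
    6 + 4 * m                                       ∎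

2+m≤6+4m : ∀ m → 2 + m ≤ 6 + 4 * m
2+m≤6+4m m = +-mono-≤ (m≤m+n 2 4) (m≤n*m m 4)

leafDown-range : ∀ m v → length v ≡ m → InRange m (length (leafDown m v))
leafDown-range m v eq rewrite length-leafDown m v eq = ≤-refl , 2+m≤6+4m m

leafUp-range : ∀ m v → length v ≡ m → InRange m (length (leafUp m v))
leafUp-range m v eq rewrite length-leafUp m v eq = 2+m≤6+4m m , ≤-refl

inZone-range : ∀ z u → members z u ≡ true → InRange (Zone.m z) (length u)
inZone-range (zone m w b refl) u eq = bySort (isZero u) refl
  where
  bySort : ∀ c → isZero u ≡ c → InRange m (length u)
  bySort true  z = digitIndex-range m (length u) (digit-< w _ (inZone-zero m w b u z eq))
  bySort false nz with inZone-leaf m w b u nz eq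
  ... | inj₁ refl = leafDown-range m w refl
  ... | inj₂ refl = leafUp-range m w refl

inZone-zeros : ∀ m w b ℓ → inZone m w b (zeros ℓ) ≡ digit w (digitIndex m ℓ)
inZone-zeros m w b ℓ rewrite isZero-zeros ℓ | List.length-replicate ℓ {false} = refl

digitIndex-down : ∀ m i j → i + suc j ≡ m → digitIndex m (position down m i j) ≡ i
digitIndex-down m i j refl = begin
  digitIndex m ℓ         ≡⟨ cong (if_then (2 + (m + m)) ∸ ℓ else (ℓ ∸ suc (inputLength m)))
                              (dec-true (ℓ <? inputLength m) ℓ<n) ⟩
  (2 + (m + m)) ∸ ℓ      ≡⟨ cong (_∸ ℓ) split ⟩
  i + ℓ ∸ ℓ              ≡⟨ m+n∸n≡m i ℓ ⟩
  i                      ∎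
  where
  open ≡-Reasoning
  ℓ = position down m i j
  split : 2 + (m + m) ≡ i + ℓ
  split = solve 2 (λ i j → let m = i :+ (con 1 :+ j) in
    con 2 :+ (m :+ m) := i :+ (con 1 :+ j :+ (con 2 :+ m))) refl i j
    where open +-*-Solver
  ℓ<n : ℓ < inputLength m
  ℓ<n = s≤s (≤-trans (m≤n+m ℓ i) (≤-reflexive (sym split)))

digitIndex-up : ∀ m i j → digitIndex m (position up m i j) ≡ i
digitIndex-up m i j = begin
  digitIndex m ℓ          ≡⟨ cong (if_then (2 + (m + m)) ∸ ℓ else (ℓ ∸ suc (inputLength m)))
                               (dec-false (ℓ <? inputLength m) (≤⇒≯ (m≤m+n (inputLength m) (suc i)))) ⟩
  ℓ ∸ suc (inputLength m) ≡⟨ cong (_∸ suc (inputLength m)) (+-suc (inputLength m) i) ⟩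
  (inputLength m + i) ∸ inputLength m ≡⟨ m+n∸m≡n (inputLength m) i ⟩
  i                       ∎
  where
  open ≡-Reasoning
  ℓ = position up m i j

record Addressing (D : Direction) : Set where
  field
    index   : ∀ m i j → i + suc j ≡ m → digitIndex m (position D m i j) ≡ i
    isLeaf  : ∀ m w b → inZone m w b (leafWord D m w) ≡ b
    inRange : ∀ m w → length w ≡ m → InRange m (length (leafWord D m w))
    -- Stated for any `v`, since outside the zones the answers that make up an address are
    -- arbitrary.
    located : ∀ m v n w b → length v ≡ m → length w ≡ n → inZone n w b (leafWord D m v) ≡ true → m ≡ n

addressing-down : Addressing down
addressing-down = record
  { index   = digitIndex-down
  ; isLeaf  = inZone-leafDown
  ; inRange = leafDown-range
  ; located = λ m v n w b v≡ w≡ eq → case inZone-leaf n w b _ (isZero-leafDown m v) eq of λ where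
      (inj₁ same)  → suc-injective (suc-injective
        (trans (sym (length-leafDown m v v≡)) (trans (cong length same) (length-leafDown n w w≡))))
      (inj₂ other) → ⊥-elim (leafDown≢leafUp m v n w other)
  }

addressing-up : Addressing up
addressing-up = record
  { index   = λ m i j _ → digitIndex-up m i j
  ; isLeaf  = inZone-leafUp
  ; inRange = leafUp-range
  ; located = λ m v n w b v≡ w≡ eq → case inZone-leaf n w b _ (isZero-leafUp m v) eq of λ where
      (inj₁ other) → ⊥-elim (leafDown≢leafUp n w m v (sym other))
      (inj₂ same)  → *-cancelˡ-≡ m n 4 (+-cancelˡ-≡ 6 (4 * m) (4 * n)
        (trans (sym (length-leafUp m v v≡)) (trans (cong length same) (length-leafUp n w w≡))))
  }

-- The oracle of a sparse sequence of zones

module Sparse (z : ℕ → Zone)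
  (sparse : ∀ e → 6 + 4 * Zone.m (z e) < Zone.m (z (suc e))) where

  open Zone

  below : ℕ → Language
  below zero    u = false
  below (suc e) u = below e u ∨ members (z e) u

  below-sound : ∀ e u → below e u ≡ true → Σ[ k ∈ ℕ ] k < e × members (z k) u ≡ true
  below-sound (suc e) u eq with below e u in eq′
  ... | false = e , ≤-refl , eq
  ... | true with k , k< , in-k ← below-sound e u eq′ = k , m≤n⇒m≤1+n k< , in-k

  below-complete : ∀ {e k} u → k < e → members (z k) u ≡ true → below e u ≡ true
  below-complete {suc e} {k} u (s≤s k≤e) in-k with m≤n⇒m<n∨m≡n k≤e
  ... | inj₁ k<e  rewrite below-complete u k<e in-k = refl
  ... | inj₂ refl rewrite in-k = Bool.∨-zeroʳ (below e u)

  abstract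
    -- A word `u` of zone `e` has length at least `m (z e)`, hence at least `e`, so only the zones
    -- with index up to `length u` are consulted and the infinite union is a Boolean function.
    oracle : Language
    oracle u = below (suc (length u)) u

    oracle≡below : ∀ u → oracle u ≡ below (suc (length u)) u
    oracle≡below u = refl

  e≤m : ∀ e → e ≤ m (z e)
  e≤m zero    = z≤n
  e≤m (suc e) = ≤-trans (s≤s (≤-trans (e≤m e) (≤-trans (m≤n*m (m (z e)) 4) (m≤n+m _ 6)))) (sparse e)

  separated : ∀ {e k} → e < k → 6 + 4 * m (z e) < m (z k)
  separated {e} {suc k} (s≤s e≤k) with m≤n⇒m<n∨m≡n e≤k
  ... | inj₂ refl = sparse e
  ... | inj₁ e<k  = <-trans (separated e<k) (≤-<-trans (≤-trans (m≤n*m (m (z k)) 4) (m≤n+m _ 6)) (sparse k))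

  oracle-sound : ∀ u → oracle u ≡ true → Σ[ e ∈ ℕ ] members (z e) u ≡ true
  oracle-sound u eq with e , _ , in-e ← below-sound (suc (length u)) u (trans (sym (oracle≡below u)) eq) = e , in-e

  oracle-complete : ∀ e u → members (z e) u ≡ true → oracle u ≡ true
  oracle-complete e u in-e = trans (oracle≡below u) (below-complete u
    (s≤s (≤-trans (e≤m e) (≤-trans (m≤n+m _ 2) (proj₁ (inZone-range (z e) u in-e))))) in-e)

  range-unique : ∀ {e k ℓ} → InRange (m (z e)) ℓ → InRange (m (z k)) ℓ → e ≡ k
  range-unique {e} {k} (l₁ , u₁) (l₂ , u₂) with <-cmp e k
  ... | tri≈ _ e≡k _ = e≡k
  ... | tri< e<k _ _ = ⊥-elim (<⇒≱ (<-≤-trans (separated e<k) (m≤n+m _ 2)) (≤-trans l₂ u₁))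
  ... | tri> _ _ k<e = ⊥-elim (<⇒≱ (<-≤-trans (separated k<e) (m≤n+m _ 2)) (≤-trans l₁ u₂))

  ≡true-ext : ∀ {a b} → (a ≡ true → b ≡ true) → (b ≡ true → a ≡ true) → a ≡ b
  ≡true-ext {true}  {b}     f g = sym (f refl)
  ≡true-ext {false} {false} f g = refl
  ≡true-ext {false} {true}  f g = g refl

  oracle-local : ∀ e u → InRange (m (z e)) (length u) → oracle u ≡ members (z e) u
  oracle-local e u r = ≡true-ext
    (λ eq → let (k , in-k) = oracle-sound u eq in
      subst (λ k → members (z k) u ≡ true) (range-unique (inZone-range (z k) u in-k) r) in-k)
    (oracle-complete e u)

  -- Words of a zone are longer than its `m`, so on short words the zones built so far already are
  -- the whole oracle.
  oracle-below : ∀ e u → length u < m (z (suc e)) → oracle u ≡ below (suc e) u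
  oracle-below e u u< = ≡true-ext
    (λ eq → let (k , in-k) = oracle-sound u eq in below-complete u (early k in-k) in-k)
    (λ eq → let (k , _ , in-k) = below-sound (suc e) u eq in oracle-complete k u in-k)
    where
    early : ∀ k → members (z k) u ≡ true → k < suc e
    early k in-k with <-cmp k (suc e)
    ... | tri< k<e _ _    = k<e
    ... | tri≈ _ refl _   = ⊥-elim (<⇒≱ u< (≤-trans (m≤n+m _ 2) (proj₁ (inZone-range (z k) u in-k))))
    ... | tri> _ _ e<k    = ⊥-elim (<⇒≱
      (<-trans u< (≤-<-trans (≤-trans (m≤n*m (m (z (suc e))) 4) (m≤n+m _ 6)) (separated e<k)))
      (≤-trans (m≤n+m _ 2) (proj₁ (inZone-range (z k) u in-k))))

  module _ {D : Direction} (addressing : Addressing D) where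
    open Addressing addressing
    open Walk D oracle

    -- Induction along a splitting of the address into the digits `p` already read and the digits
    -- `s` still to be asked, since `position` depends on both counts.
    answers-address : ∀ e p s → p ++ s ≡ w (z e) → answers (m (z e)) (length p) (length s) ≡ s
    answers-address e p []      eq = refl
    answers-address e p (b ∷ s) eq = cong₂ _∷_ found
      (trans (cong (λ i → answers (m (z e)) i (length s)) (sym (trans (List.length-++ p) (+-comm (length p) 1))))
        (answers-address e (p ++ [ b ]) s (trans (List.++-assoc p [ b ] s) eq)))
      where
      open ≡-Reasoning
      ℓ = position D (m (z e)) (length p) (length s)

      total : length p + suc (length s) ≡ m (z e)
      total = trans (sym (List.length-++ p)) (trans (cong length eq) (fits (z e)))

      ℓ-index : digitIndex (m (z e)) ℓ ≡ length p
      ℓ-index = index (m (z e)) (length p) (length s) total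

      ℓ-range : InRange (m (z e)) (length (zeros ℓ))
      ℓ-range rewrite List.length-replicate ℓ {false} = digitIndex-range (m (z e)) ℓ
        (≤-trans (s≤s (≤-reflexive ℓ-index)) (≤-trans (m<m+n (length p) (s≤s z≤n)) (≤-reflexive total)))

      found : oracle (zeros ℓ) ≡ b
      found = begin
        oracle (zeros ℓ)                       ≡⟨ oracle-local e (zeros ℓ) ℓ-range ⟩
        members (z e) (zeros ℓ)                ≡⟨ inZone-zeros (m (z e)) (w (z e)) _ ℓ ⟩
        digit (w (z e)) (digitIndex (m (z e)) ℓ) ≡⟨ cong₂ digit (sym eq) ℓ-index ⟩
        digit (p ++ b ∷ s) (length p)          ≡⟨ digit-++ p b s ⟩
        b                                      ∎

    oracle-leafQuery : ∀ e → oracle (leafQuery (m (z e))) ≡ b (z e)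
    oracle-leafQuery e = begin
      oracle (leafQuery (m (z e)))             ≡⟨ cong (oracle ∘ leafWord D (m (z e))) address ⟩
      oracle (leafWord D (m (z e)) (w (z e)))  ≡⟨ oracle-local e (leafWord D (m (z e)) (w (z e)))
                                                     (inRange (m (z e)) (w (z e)) (fits (z e))) ⟩
      members (z e) (leafWord D (m (z e)) (w (z e))) ≡⟨ isLeaf (m (z e)) (w (z e)) (b (z e)) ⟩
      b (z e)                                  ∎
      where
      open ≡-Reasoning
      address : answers (m (z e)) 0 (m (z e)) ≡ w (z e)
      address = trans (cong (answers (m (z e)) 0) (sym (fits (z e)))) (answers-address e [] (w (z e)) refl)

    leafQuery-located : ∀ n → oracle (leafQuery n) ≡ true → Σ[ e ∈ ℕ ] n ≡ m (z e)
    leafQuery-located n eq with e , in-e ← oracle-sound (leafQuery n) eq =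
      e , located n _ (m (z e)) (w (z e)) (b (z e)) (length-answers n 0 n) (fits (z e)) in-e

  -- If either leaf is in the oracle, then `n` belongs to a zone and both leaves carry its answer;
  -- otherwise both are absent, whatever addresses the walks have read.
  leafQuery-agree : ∀ n → oracle (Walk.leafQuery up oracle n) ≡ oracle (Walk.leafQuery down oracle n)
  leafQuery-agree n = ≡true-ext (transfer addressing-up addressing-down) (transfer addressing-down addressing-up)
    where
    transfer : ∀ {D E} → Addressing D → Addressing E →
      oracle (Walk.leafQuery D oracle n) ≡ true → oracle (Walk.leafQuery E oracle n) ≡ true
    transfer aD aE eq with e , refl ← leafQuery-located aD n eq =
      trans (oracle-leafQuery aE e) (trans (sym (oracle-leafQuery aD e)) eq)

-- Diagonalization

tailsAfter : Bool → List Word → List Word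
tailsAfter b []                = []
tailsAfter b ([] ∷ E)          = tailsAfter b E
tailsAfter false ((false ∷ w) ∷ E) = w ∷ tailsAfter false E
tailsAfter false ((true  ∷ w) ∷ E) = tailsAfter false E
tailsAfter true  ((false ∷ w) ∷ E) = tailsAfter true E
tailsAfter true  ((true  ∷ w) ∷ E) = w ∷ tailsAfter true E

length-tailsAfter : ∀ E → length (tailsAfter false E) + length (tailsAfter true E) ≤ length E
length-tailsAfter []                = z≤n
length-tailsAfter ([] ∷ E)          = m≤n⇒m≤1+n (length-tailsAfter E)
length-tailsAfter ((false ∷ w) ∷ E) = s≤s (length-tailsAfter E)
length-tailsAfter ((true ∷ w) ∷ E)  =
  ≤-trans (≤-reflexive (+-suc _ _)) (s≤s (length-tailsAfter E))

∈-tailsAfter : ∀ {b w} E → (b ∷ w) ∈ˡ E → w ∈ˡ tailsAfter b E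
∈-tailsAfter {b}     ([] ∷ E)          (there p)   = ∈-tailsAfter E p
∈-tailsAfter {false} ((false ∷ w) ∷ E) (here refl) = here refl
∈-tailsAfter {false} ((false ∷ w) ∷ E) (there p)   = there (∈-tailsAfter E p)
∈-tailsAfter {false} ((true ∷ w) ∷ E)  (there p)   = ∈-tailsAfter E p
∈-tailsAfter {true}  ((false ∷ w) ∷ E) (there p)   = ∈-tailsAfter E p
∈-tailsAfter {true}  ((true ∷ w) ∷ E)  (here refl) = here refl
∈-tailsAfter {true}  ((true ∷ w) ∷ E)  (there p)   = there (∈-tailsAfter E p)

-- Descends the binary tree of addresses; if `E` has fewer entries than the tree has leaves, the
-- same holds for at least one of the two subtrees.
avoid : ℕ → List Word → Word
avoid zero    E = []
avoid (suc m) E with length (tailsAfter false E) <? 2 ^ m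
... | yes _ = false ∷ avoid m (tailsAfter false E)
... | no  _ = true  ∷ avoid m (tailsAfter true E)

length-avoid : ∀ m E → length (avoid m E) ≡ m
length-avoid zero    E = refl
length-avoid (suc m) E with length (tailsAfter false E) <? 2 ^ m
... | yes _ = cong suc (length-avoid m (tailsAfter false E))
... | no  _ = cong suc (length-avoid m (tailsAfter true E))

avoid-∉ : ∀ m E → length E < 2 ^ m → avoid m E ∉ˡ E
avoid-∉ zero    (w ∷ E) (s≤s ()) _
avoid-∉ (suc m) E few with length (tailsAfter false E) <? 2 ^ m
... | yes fewer = avoid-∉ m (tailsAfter false E) fewer ∘ ∈-tailsAfter E
... | no  many  = avoid-∉ m (tailsAfter true E) fewer ∘ ∈-tailsAfter E
  where
  open ≤-Reasoning
  fewer : length (tailsAfter true E) < 2 ^ m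
  fewer = +-cancelˡ-< (2 ^ m) _ _ (begin-strict
    2 ^ m + length (tailsAfter true E)                      ≤⟨ +-monoˡ-≤ _ (≮⇒≥ many) ⟩
    length (tailsAfter false E) + length (tailsAfter true E) ≤⟨ length-tailsAfter E ⟩
    length E                                                <⟨ few ⟩
    2 ^ m + (2 ^ m + 0)                                     ≡⟨ cong (2 ^ m +_) (+-identityʳ (2 ^ m)) ⟩
    2 ^ m + 2 ^ m                                           ∎)

take-length-++ : ∀ (v u : Word) → take (length v) (v ++ u) ≡ v
take-length-++ []      u = refl
take-length-++ (b ∷ v) u = cong (b ∷_) (take-length-++ v u)

-- Defined on all words: each query rules out one address per direction, without a test whether it
-- is a leaf. Hence the doubled count in `growth`.
addressDown addressUp : ℕ → Word → Word
addressDown m u = take m (drop 1 u)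
addressUp   m u = take m (drop 1 (reverse u))

addressDown-leafDown : ∀ m v → length v ≡ m → addressDown m (leafDown m v) ≡ v
addressDown-leafDown _ v refl = take-length-++ v [ true ]

addressUp-leafUp : ∀ m v → length v ≡ m → addressUp m (leafUp m v) ≡ v
addressUp-leafUp m v refl = trans
  (cong (take m ∘ drop 1) (List.reverse-involutive (false ∷ v ++ true ∷ zeros (inputLength m + suc m))))
  (take-length-++ v (true ∷ zeros (inputLength m + suc m)))

leadingBits-bits : ∀ {g} w → leadingBits {g} (bits w) ≡ w
leadingBits-bits []      = refl
leadingBits-bits (b ∷ w) = cong (b ∷_) (leadingBits-bits w)

length-leadingBits : ∀ {g} (w : List (Symbol g)) → length (leadingBits w) ≤ length w
length-leadingBits []          = z≤n
length-leadingBits (blank ∷ w) = z≤n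
length-leadingBits (bit _ ∷ w) = s≤s (length-leadingBits w)
length-leadingBits (comma ∷ w) = z≤n
length-leadingBits (aux _ ∷ w) = z≤n

length-bits : ∀ {g} w → length (bits {g} w) ≡ length w
length-bits w = List.length-map bit w

length-outputAfter : ∀ M t w → length (outputAfter M t w) ≤ t + suc (length w)
length-outputAfter M t w = ≤-trans
  (length-leadingBits (outputWord M (run M ∅ t (initial M (bits w)))))
  (≤-trans (length-outputWord M ∅ t (bits w)) (≤-reflexive (cong (λ l → t + suc l) (length-bits w))))

∈-sum : ∀ {q : Word} qs → q ∈ˡ qs → length q ≤ sum (map length qs)
∈-sum (q ∷ qs) (here refl) = m≤m+n (length q) (sum (map length qs))
∈-sum (q ∷ qs) (there p)   = ≤-trans (∈-sum qs p) (m≤n+m (sum (map length qs)) (length q))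

verdict-cong : ∀ {D E} X → (∀ m → X (Walk.leafQuery D X m) ≡ X (Walk.leafQuery E X m)) →
  ∀ n → Walk.verdict D X n ≡ Walk.verdict E X n
verdict-cong X agree n with addressSize n
... | just m  = agree m
... | nothing = refl

accepting-accept : ∀ {s t g} (i : Instruction s t g) → accepting i ≡ true → i ≡ accept
accepting-accept accept _ = refl

-- `D` has halted at its time bound, so the Boolean computed there decides acceptance.
diagonal : ∀ (D : DPTM) a {c} →
  c ≡ not (acceptsWithin (DPTM.machine D) (eval (DPTM.bound D) (length a)) a) →
  ¬ (D accepts a with-oracle ∅ ⇔ T c)
diagonal D a {c} c≡ correct = contradict c c≡ correct
  where
  open DPTM D
  t = eval bound (length a)

  contradict : ∀ c → c ≡ not (acceptsWithin machine t a) → ¬ (D accepts a with-oracle ∅ ⇔ T c)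
  contradict true c≡ correct = case trans c≡ (cong (not ∘ accepting)
    (Execution.accepts-halted machine ∅ {t} {bits a} (halts ∅ a) (Equivalence.from correct tt))) of λ ()
  contradict false c≡ correct = Equivalence.to correct
    (t , accepting-accept (current machine (run machine ∅ t (initial machine (bits a))))
      (Bool.not-injective (sym c≡)))

-- The stages and the sets `A` and `B`

module Diagonalization (P : PairingFunction) where
  open PairingFunction P

  inverter : Machine
  inverter = proj₁ invertible

  inverterBound : Polynomial
  inverterBound = proj₁ (proj₂ (proj₂ invertible))

  inverted : Word → List (Symbol (Machine.g inverter))
  inverted y = outputWord inverter
    (run inverter ∅ (eval inverterBound (length (bits {Machine.g inverter} y))) (initial inverter (bits y)))

  inverted-⟨⟩ : ∀ qs → inverted ⟨ qs ⟩ ≡ tuple qs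
  inverted-⟨⟩ qs = proj₂ (proj₂ (proj₂ (proj₂ invertible)) qs)

  unpaired : Word → List Word
  unpaired y = untuple (inverted y)

  unpaired-⟨⟩ : ∀ qs → unpaired ⟨ qs ⟩ ≡ qs
  unpaired-⟨⟩ qs = trans (cong untuple (inverted-⟨⟩ qs)) (untuple-tuple qs)

  unpairedBound : ℕ → ℕ
  unpairedBound l = eval inverterBound l + suc l

  length-inverted : ∀ y → length (inverted y) ≤ unpairedBound (length y)
  length-inverted y = ≤-trans
    (length-outputWord inverter ∅ (eval inverterBound (length (bits {Machine.g inverter} y))) (bits y))
    (≤-reflexive (cong unpairedBound (length-bits {Machine.g inverter} y)))

  -- The inverting machine has to write out all components within a time polynomial in the length of
  -- the code.
  length-components : ∀ qs → length qs ≤ unpairedBound (length ⟨ qs ⟩)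
  length-components qs = begin
    length qs                              ≤⟨ length-tuple {Machine.g inverter} qs ⟩
    length (tuple {Machine.g inverter} qs) ≡⟨ cong length (inverted-⟨⟩ qs) ⟨
    length (inverted ⟨ qs ⟩)               ≤⟨ length-inverted ⟨ qs ⟩ ⟩
    unpairedBound (length ⟨ qs ⟩)          ∎
    where open ≤-Reasoning

  module Stage (M : Machine) (pM : Polynomial) (F : Machine) (pF : Polynomial)
               (earlier : Language) (floor : ℕ) where

    outputBound : ℕ → ℕ
    outputBound n = eval pF n + suc n

    growth : PolynomiallyBounded (λ m → let q = unpairedBound (outputBound (inputLength m)) in q + q)
    growth = +-bounded queries-bounded queries-bounded
      where
      suc-bounded : ∀ {f} → PolynomiallyBounded f → PolynomiallyBounded (suc ∘ f)
      suc-bounded = +-bounded (const-bounded 1)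

      input-bounded : PolynomiallyBounded inputLength
      input-bounded = +-bounded (const-bounded 3) (+-bounded id-bounded id-bounded)

      output-bounded : PolynomiallyBounded (outputBound ∘ inputLength)
      output-bounded = +-bounded (eval-bounded pF input-bounded) (suc-bounded input-bounded)

      queries-bounded : PolynomiallyBounded (unpairedBound ∘ outputBound ∘ inputLength)
      queries-bounded = +-bounded (eval-bounded inverterBound output-bounded) (suc-bounded output-bounded)

    abstract
      chosen : Σ[ m ∈ ℕ ] floor ≤ m × (let q = unpairedBound (outputBound (inputLength m)) in q + q < 2 ^ m)
      chosen = eventually<2^ growth floor

    m : ℕ
    m = proj₁ chosen

    x : Word
    x = zeros (inputLength m)

    y : Word
    y = outputAfter F (eval pF (length x)) x

    qs : List Word
    qs = unpaired y

    excluded : List Word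
    excluded = map (addressDown m) qs ++ map (addressUp m) qs

    w : Word
    w = avoid m excluded

    -- The answer `b` is computed from these values and cannot enter them; `false` stands in for it,
    -- which `unasked` justifies.
    answer : Word → Bool
    answer q = earlier q ∨ inZone m w false q

    evaluated : Word
    evaluated = ⟨ x ∷ map (λ q → [ answer q ]) qs ⟩

    b : Bool
    b = not (acceptsWithin M (eval pM (length evaluated)) evaluated)

    newZone : Zone
    newZone = zone m w b (length-avoid m excluded)

    -- Exceeds the lengths of all words of this zone and, the sum being at least the maximum, of all
    -- queries of this stage; later zones leave both alone.
    newFloor : ℕ
    newFloor = suc (6 + 4 * m + sum (map length qs))

    length-x : length x ≡ inputLength m
    length-x = List.length-replicate (inputLength m)

    -- The stage runs the enumerated `F`, which shares only its behaviour with the generator `F₀` of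
    -- the given reduction.
    y-computed : ∀ {F₀ pF₀} {f : Word → Word} → F ≈ᴹ F₀ → pF ≡ pF₀ →
      (∀ x → let w = bits {Machine.g F₀} x in
        outputWord F₀ (run F₀ ∅ (eval pF₀ (length w)) (initial F₀ w)) ≡ bits (f x)) →
      y ≡ f x
    y-computed {F₀} {f = f} F≈ refl computes = begin
      outputAfter F (eval pF (length x)) x
        ≡⟨ proj₂ (F≈ (eval pF (length x)) x) ⟩
      outputAfter F₀ (eval pF (length x)) x
        ≡⟨ cong (λ l → outputAfter F₀ (eval pF l) x) (length-bits {Machine.g F₀} x) ⟨
      outputAfter F₀ (eval pF (length (bits {Machine.g F₀} x))) x
        ≡⟨ cong leadingBits (computes x) ⟩
      leadingBits (bits {Machine.g F₀} (f x))
        ≡⟨ leadingBits-bits (f x) ⟩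
      f x ∎
      where open ≡-Reasoning

    b-computed : ∀ {M₀ pM₀ a} → M ≈ᴹ M₀ → pM ≡ pM₀ → evaluated ≡ a →
      b ≡ not (acceptsWithin M₀ (eval pM₀ (length a)) a)
    b-computed M≈ refl refl = cong not (proj₁ (M≈ (eval pM (length evaluated)) evaluated))

    module _ {qs₀ : List Word} (y≡ : y ≡ ⟨ qs₀ ⟩) where

      qs≡ : qs ≡ qs₀
      qs≡ = trans (cong unpaired y≡) (unpaired-⟨⟩ qs₀)

      few : length qs ≤ unpairedBound (outputBound (inputLength m))
      few = begin
        length qs                       ≡⟨ cong length qs≡ ⟩
        length qs₀                      ≤⟨ length-components qs₀ ⟩
        unpairedBound (length ⟨ qs₀ ⟩)  ≡⟨ cong (unpairedBound ∘ length) y≡ ⟨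
        unpairedBound (length y)        ≤⟨ +-mono-≤ (eval-mono inverterBound y≤) (s≤s y≤) ⟩
        unpairedBound (outputBound (inputLength m)) ∎
        where
        open ≤-Reasoning
        y≤ : length y ≤ outputBound (inputLength m)
        y≤ = ≤-trans (length-outputAfter F _ x) (≤-reflexive (cong outputBound length-x))

      w-avoids : w ∉ˡ excluded
      w-avoids = avoid-∉ m excluded (begin-strict
        length excluded                         ≡⟨ List.length-++ (map (addressDown m) qs) ⟩
        length (map (addressDown m) qs) + length (map (addressUp m) qs)
                                                ≡⟨ cong₂ _+_ (List.length-map (addressDown m) qs)
                                                             (List.length-map (addressUp m) qs) ⟩
        length qs + length qs                   ≤⟨ +-mono-≤ few few ⟩
        unpairedBound (outputBound (inputLength m)) + unpairedBound (outputBound (inputLength m))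
                                                <⟨ proj₂ (proj₂ chosen) ⟩
        2 ^ m                                   ∎)
        where open ≤-Reasoning

      -- If `q` were one of the two leaves of `w`, decoding it would put `w` among the excluded
      -- addresses.
      unasked : ∀ {q} → q ∈ˡ qs → inZone m w b q ≡ inZone m w false q
      unasked {q} q∈ = inZone-elsewhere m w b false q
        (λ { refl → w-avoids (∈-++⁺ˡ (subst (_∈ˡ map (addressDown m) qs)
               (addressDown-leafDown m w (length-avoid m excluded)) (∈-map⁺ (addressDown m) q∈))) })
        (λ { refl → w-avoids (∈-++⁺ʳ (map (addressDown m) qs) (subst (_∈ˡ map (addressUp m) qs)
               (addressUp-leafUp m w (length-avoid m excluded)) (∈-map⁺ (addressUp m) q∈))) })

  record State : Set where
    field
      language : Language
      floor    : ℕ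

  module StageOf (e : ℕ) (s : State) = Stage
    (proj₁ (proj₁ (Enumeration.enum Candidate-enum e))) (proj₂ (proj₁ (Enumeration.enum Candidate-enum e)))
    (proj₁ (proj₂ (Enumeration.enum Candidate-enum e))) (proj₂ (proj₂ (Enumeration.enum Candidate-enum e)))
    (State.language s) (State.floor s)

  state : ℕ → State
  state zero    = record { language = ∅ ; floor = 0 }
  state (suc e) = record
    { language = λ u → State.language (state e) u ∨ members (StageOf.newZone e (state e)) u
    ; floor    = StageOf.newFloor e (state e)
    }

  module At (e : ℕ) = StageOf e (state e)

  z : ℕ → Zone
  z e = At.newZone e

  floor≤ : ∀ e → suc (6 + 4 * At.m e + sum (map length (At.qs e))) ≤ At.m (suc e)
  floor≤ e = proj₁ (proj₂ (At.chosen (suc e)))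

  open Sparse z (λ e → ≤-trans (s≤s (m≤m+n _ _)) (floor≤ e)) public

  language≗below : ∀ e u → State.language (state e) u ≡ below e u
  language≗below zero    u = refl
  language≗below (suc e) u = cong (_∨ members (z e) u) (language≗below e u)

  A B : Language
  A = oracle
  B x = Walk.verdict down A (length x)

  open Walk using (verdict; queriesAt)

  verdict-agree : ∀ n → verdict up A n ≡ verdict down A n
  verdict-agree = verdict-cong {up} {down} A leafQuery-agree

  verdict-stage : ∀ e → verdict down A (inputLength (At.m e)) ≡ At.b e
  verdict-stage e = trans (Walk.verdict-inputLength down A (At.m e)) (oracle-leafQuery addressing-down e)

  -- Two replacements are justified: the stand-in `false` by `unasked`, and the restriction to the
  -- zones built so far by the floor of the next stage.
  answer-correct : ∀ e {qs₀} → At.y e ≡ ⟨ qs₀ ⟩ → ∀ {q} → q ∈ˡ At.qs e → At.answer e q ≡ A q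
  answer-correct e y≡ {q} q∈ = begin
    State.language (state e) q ∨ inZone m w false q ≡⟨ cong₂ _∨_ (language≗below e q) (sym (unasked y≡ q∈)) ⟩
    below (suc e) q                                 ≡⟨ oracle-below e q q< ⟨
    A q                                             ∎
    where
    open ≡-Reasoning
    open At e
    q< : length q < At.m (suc e)
    q< = ≤-trans (s≤s (≤-trans (∈-sum qs q∈) (m≤n+m _ (6 + 4 * m)))) (floor≤ e)

  map-answers : ∀ e {qs₀} → At.y e ≡ ⟨ qs₀ ⟩ →
    map (λ q → [ At.answer e q ]) (At.qs e) ≡ map (λ q → [ A q ]) qs₀
  map-answers e y≡ = trans (agreeing (At.qs e) (answer-correct e y≡)) (cong (map _) (At.qs≡ e y≡))
    where
    agreeing : ∀ qs → (∀ {q} → q ∈ˡ qs → At.answer e q ≡ A q) →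
      map (λ q → [ At.answer e q ]) qs ≡ map (λ q → [ A q ]) qs
    agreeing []       ok = refl
    agreeing (q ∷ qs) ok = cong₂ _∷_ (cong [_] (ok (here refl))) (agreeing qs (ok ∘ there))

  not-reducible : ¬ (B ≤tt[ P ] A)
  not-reducible (D , _ , f , (F , _ , pF , computes) , reduces) = refute
    (Enumeration.reaches Candidate-enum ((DPTM.machine D , DPTM.bound D) , (F , pF)))
    where
    refute : (Σ[ e ∈ ℕ ] ((_≈ᴹ_ ⊗ _≡_) ⊗ (_≈ᴹ_ ⊗ _≡_)) (Enumeration.enum Candidate-enum e)
               ((DPTM.machine D , DPTM.bound D) , (F , pF))) → ⊥
    refute (e , (D≈ , pD≡) , (F≈ , pF≡)) = diagonal D a b≡ (subst (λ c → D accepts a with-oracle ∅ ⇔ T c) B≡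
      (proj₂ (proj₂ (reduces (At.x e)))))
      where
      qs₀ : List Word
      qs₀ = proj₁ (reduces (At.x e))

      y≡ : At.y e ≡ ⟨ qs₀ ⟩
      y≡ = trans (At.y-computed e F≈ pF≡ (λ x → proj₂ (computes x))) (proj₁ (proj₂ (reduces (At.x e))))

      a : Word
      a = ⟨ At.x e ∷ map (λ q → [ A q ]) qs₀ ⟩

      -- The stage ran an equivalent machine on provisional answers; both are exchanged here for the
      -- actual ones.
      b≡ : At.b e ≡ not (acceptsWithin (DPTM.machine D) (eval (DPTM.bound D) (length a)) a)
      b≡ = At.b-computed e D≈ pD≡ (cong (λ as → ⟨ At.x e ∷ as ⟩) (map-answers e y≡))

      B≡ : B (At.x e) ≡ At.b e
      B≡ = trans (cong (verdict down A) (At.length-x e)) (verdict-stage e)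

  reducible-along : ∀ {_~_} D → (∀ n → verdict D A n ≡ verdict down A n) →
    (∀ n → Linked _~_ (n ∷ map length (queriesAt D A n))) → TuringReducibleAlong _~_ B A
  reducible-along {_~_} D agree linked = walkerDPTM D ,
    (λ x → subst (λ v → walkerDPTM D accepts x with-oracle A ⇔ T v) (agree (length x))
       (Walk.walker-accepts D A (timeBound-enough (length x)))) ,
    (λ x → subst (λ qs → Linked _~_ (length x ∷ map length qs))
       (sym (Walk.walker-queries D A {x = x} (timeBound-enough (length x)))) (linked (length x)))

-- Strictly monotone query lengths

data SizeView (n : ℕ) : Set where
  none : addressSize n ≡ nothing → SizeView n
  some : ∀ m → n ≡ inputLength m → SizeView n

sizeView : ∀ n → SizeView n
sizeView n with shape n
... | short z≤n             = none refl
... | short (s≤s z≤n)       = none refl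
... | short (s≤s (s≤s z≤n)) = none refl
... | balanced m            = some m refl
... | lopsided m            = none (half-double+1 m)

linked-queriesAt : ∀ {_~_ : ℕ → ℕ → Set} D X →
  (∀ m → Linked _~_ (inputLength m ∷ map length (Walk.addressQueries D X m 0 m ++ [ Walk.leafQuery D X m ]))) →
  ∀ n → Linked _~_ (n ∷ map length (Walk.queriesAt D X n))
linked-queriesAt D X linked n with sizeView n
... | none eq rewrite eq = [-]
... | some m refl rewrite half-double m = linked m

linked-down : ∀ X n → Linked _>_ (n ∷ map length (Walk.queriesAt down X n))
linked-down X = linked-queriesAt down X λ m →
  subst (λ n → Linked _>_ (n ∷ map length (addressQueries m 0 m ++ [ leafQuery m ])))
    (cong suc (trans (+-suc m (suc m)) (cong suc (+-suc m m)))) (from m 0 m)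
  where
  open Walk down X
  -- The head of the list is one above the length of the next query; for `j = m` it is the input
  -- length itself.
  from : ∀ m i j → Linked _>_ (suc j + suc (suc m) ∷ map length (addressQueries m i j ++ [ leafQuery m ]))
  from m i zero    = ≤-reflexive (cong suc (length-leafDown m (answers m 0 m) (length-answers m 0 m))) ∷ [-]
  from m i (suc j) rewrite List.length-replicate (suc j + suc (suc m)) {false} = ≤-refl ∷ from m (suc i) j

linked-up : ∀ X n → Linked _<_ (n ∷ map length (Walk.queriesAt up X n))
linked-up X = linked-queriesAt up X λ m →
  subst (λ n → Linked _<_ (n ∷ map length (addressQueries m 0 m ++ [ leafQuery m ])))
    (+-identityʳ (inputLength m)) (from m 0 m refl)
  where
  open Walk up X
  -- The equation shows in the last case that the longest unary query has length
  -- `inputLength m + m`, which is below the leaf length `6 + 4 * m`.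
  from : ∀ m i j → i + j ≡ m →
    Linked _<_ (inputLength m + i ∷ map length (addressQueries m i j ++ [ leafQuery m ]))
  from m i zero eq = ≤-trans (s≤s bound)
    (≤-reflexive (sym (length-leafUp m (answers m 0 m) (length-answers m 0 m)))) ∷ [-]
    where
    open ≤-Reasoning
    bound : inputLength m + i ≤ 5 + 4 * m
    bound = begin
      3 + (m + m) + i   ≡⟨ cong (inputLength m +_) (trans (sym (+-identityʳ i)) eq) ⟩
      3 + (m + m) + m   ≡⟨ cong (3 +_) (+-assoc m m m) ⟩
      3 + (m + (m + m)) ≤⟨ +-mono-≤ (m≤m+n 3 2) (+-monoʳ-≤ m (+-monoʳ-≤ m (m≤m+n m _))) ⟩
      5 + 4 * m         ∎
  from m i (suc j) eq = ≤-reflexive (trans (sym (+-suc (inputLength m) i)) (sym position≡)) ∷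
    subst (λ l → Linked _<_ (l ∷ map length (addressQueries m (suc i) j ++ [ leafQuery m ]))) (sym position≡)
      (from m (suc i) j (trans (sym (+-suc i j)) eq))
    where
    position≡ : length (zeros (inputLength m + suc i)) ≡ inputLength m + suc i
    position≡ = List.length-replicate (inputLength m + suc i)

theorem4p7 : (P : PairingFunction) →
    Σ[ A ∈ Language ] Σ[ B ∈ Language ]
    (B ≤s-li-T A × B ≤s-ld-T A × ¬ (B ≤tt[ P ] A))
theorem4p7 P = A , B ,
  reducible-along up verdict-agree (linked-up A) ,
  reducible-along down (λ _ → refl) (linked-down A) ,
  not-reducible
  where open Diagonalization P
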